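{- Let $k\ge0$ be an integer, let $\mathcal H$ be a $(k+1,k+1)$-partition-connected hypergraph, and let $\vec{\mathcal H}$ and $\vec{\mathcal H}'$ be two $k$-hyperarc-connected orientations of $\mathcal H$. Then there exists a sequence $\vec{\mathcal H}=\vec{\mathcal H}_0,\vec{\mathcal H}_1,\ldots,\vec{\mathcal H}_\ell=\vec{\mathcal H}'$ of $k$-hyperarc-connected orientations of $\mathcal H$ such that each $\vec{\mathcal H}_i$ ($1\le i\le\ell$) arises from $\vec{\mathcal H}_{i-1}$ by reorienting a single hyperarc.
   Context: A hypergraph $\mathcal H=(V,\mathcal E)$ consists of a finite vertex set $V$ and a finite multiset $\mathcal E$ of nonempty subsets of $V$ (hyperedges). For a partition $\mathcal P$ of $V$ into nonempty parts, $e_{\mathcal H}(\mathcal P)$ denotes the number of hyperedges meeting at least two parts of $\mathcal P$; $\mathcal H$ is $(k,k)$-partition-connected if $e_{\mathcal H}(\mathcal P)\ge k|\mathcal P|$ for every such partition $\mathcal P$. Orienting a hyperedge $Z$ towards a vertex $v\in Z$ yields the hyperarc $(Z\setminus\{v\},v)$, with tail set $Z\setminus\{v\}$ and head $v$. An orientation of $\mathcal H$ is obtained by orienting every hyperedge (it is the multiset of resulting hyperarcs). For $\emptyset\ne X\subsetneq V$, the out-degree $d^+(X)$ is the number of hyperarcs $(Y,v)$ with $v\notin X$ and $Y\cap X\neq\emptyset$; an orientation is $k$-hyperarc-connected if $d^+(X)\ge k$ for every $\emptyset\neq X\subsetneq V$. Reorienting a hyperarc $(Y,v)$ towards a vertex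 $u\in Y$ means replacing it by the hyperarc $((Y\setminus\{u\})\cup\{v\},u)$. -}

module Defs where

open import Data.Fin using (Fin)
open import Data.Fin.Subset using (Subset; _∈_; _∩_; _∪_; _-_; _⊂_; ⁅_⁆; ⊤; Nonempty; Empty)
open import Data.Fin.Subset.Properties using (_∈?_; nonempty?)
open import Data.List using (List; _∷_; length; filter)
open import Data.List.Relation.Binary.Permutation.Propositional using (_↭_)
open import Data.List.Relation.Binary.Pointwise using (Pointwise)
open import Data.List.Relation.Unary.All using (All)
open import Data.List.Relation.Unary.AllPairs using (AllPairs)
open import Data.List.Relation.Unary.Any using (Any)
open import Data.Nat using (ℕ; _*_; _≤_; _≤?_)
open import Data.Product using (∃-syntax; _×_)
open import Relation.Binary.PropositionalEquality using (_≡_)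
open import Relation.Nullary.Decidable using (¬?; _×-dec_)

-- The vertex set is Fin n.  A finite multiset is a list considered up to
-- permutation (_↭_).

record Hypergraph (n : ℕ) : Set where
  field
    edges    : List (Subset n)
    nonempty : All Nonempty edges

open Hypergraph public

record IsPartition {n : ℕ} (P : List (Subset n)) : Set where
  field
    nonemptyParts : All Nonempty P
    disjoint      : AllPairs (λ X Y → Empty (X ∩ Y)) P
    covers        : (v : Fin n) → Any (v ∈_) P

partsMet : ∀ {n} → List (Subset n) → Subset n → ℕ
partsMet P Z = length (filter (λ X → nonempty? (Z ∩ X)) P)

crossingEdges : ∀ {n} → Hypergraph n → List (Subset n) → ℕ
crossingEdges H P = length (filter (λ Z → 2 ≤? partsMet P Z) (edges H))

-- (k,k)-partition-connectedness.  As usual for this notion, only partitions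
-- with at least two parts count: no hyperedge crosses the one-part partition,
-- so including it would leave no examples with k ≥ 1 on a nonempty vertex set.
PartitionConnected : ∀ {n} → ℕ → Hypergraph n → Set
PartitionConnected k H =
  ∀ P → IsPartition P → 2 ≤ length P → k * length P ≤ crossingEdges H P

record Hyperarc (n : ℕ) : Set where
  constructor hyperarc
  field
    tail : Subset n
    head : Fin n

open Hyperarc public

orientTowards : ∀ {n} → Subset n → Fin n → Hyperarc n
orientTowards Z v = hyperarc (Z - v) v

_OrientsTo_ : ∀ {n} → Subset n → Hyperarc n → Set
Z OrientsTo a = ∃[ v ] (v ∈ Z × a ≡ orientTowards Z v)

IsOrientation : ∀ {n} → Hypergraph n → List (Hyperarc n) → Set
IsOrientation H A = ∃[ B ] (Pointwise _OrientsTo_ (edges H) B × B ↭ A)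

outDegree : ∀ {n} → List (Hyperarc n) → Subset n → ℕ
outDegree A X =
  length (filter (λ a → ¬? (head a ∈? X) ×-dec nonempty? (tail a ∩ X)) A)

HyperarcConnected : ∀ {n} → ℕ → List (Hyperarc n) → Set
HyperarcConnected k A = ∀ X → Nonempty X → X ⊂ ⊤ → k ≤ outDegree A X

reorient : ∀ {n} → Hyperarc n → Fin n → Hyperarc n
reorient (hyperarc Y v) u = hyperarc ((Y - u) ∪ ⁅ v ⁆) u

-- As multisets, B is A with one occurrence of a hyperarc a replaced by
-- a reorientation of a.
ReorientsOneTo : ∀ {n} → List (Hyperarc n) → List (Hyperarc n) → Set
ReorientsOneTo A B =
  ∃[ a ] ∃[ u ] ∃[ C ] (u ∈ tail a × A ↭ a ∷ C × B ↭ reorient a u ∷ C)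

IsConnectedOrientation : ∀ {n} → ℕ → Hypergraph n → List (Hyperarc n) → Set
IsConnectedOrientation k H A = IsOrientation H A × HyperarcConnected k A

{-# OPTIONS --safe #-}

-- The in-degree function of an orientation is F X = m(X) − i(X), where m counts the heads at each vertex and
-- i(X) counts the hyperedges inside X; so k-connectivity depends on m only, and F is submodular.
--
-- (1) There is an integer vector m* with F ≥ k + 1 on all proper sets.  Fix a root r and view F and
-- G X = F (∁ X) on the sets avoiding r.  One unit at a time is moved between vertices, raising first the bound
-- on F and then the bound on G from k to k + 1, on the subsets of a growing set A.  A minimal violating set W
-- contains a vertex v in no F-tight subset of W, since otherwise F-tight sets would partition W against
-- partition-connectivity; the unit goes from v to r or to a suitable vertex of the minimal F-tight set at v.
--
-- (2) Every k-connected orientation can be flipped to one with head counts m*.  Let d = m* − m.  Take N minimal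
-- among the sets with out-degree ≤ k that contain a set of in-degree k (or N = V).  From certain vertices u
-- with d u > 0, directed walks using only vertices y for which m + χ u − χ y stays k-connected reach all of N,
-- hence some v with d v < 0.  Flipping the walk arc by arc from its start u decreases Σ |d|.
--
-- (3) Two orientations with the same head counts m* differ by closed walks of hyperedges; flipping these one by
-- one changes every degree by at most one, so at least k remains of k + 1.
module Submission where

open import Algebra.Properties.CommutativeMonoid.Sum using ()
open import Data.Bool using (Bool; true; false; not; _∧_; _∨_; if_then_else_)
open import Data.Empty using (⊥-elim)
open import Data.Fin using (Fin; zero; suc; fromℕ; inject₁)
import Data.Fin.Properties as Fin
open import Data.Fin.Subset using (Subset; inside; outside; _∈_; _∉_; _⊆_; _⊂_; _⊃_; _∩_; _∪_; _─_; _-_; ∁; ⁅_⁆; ⊤; ⊥; Nonempty; Empty)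
open import Data.Fin.Subset.Properties
open import Data.Fin.Subset.Induction using (⊂-wellFounded; ⊃-wellFounded)
open import Data.Integer using (ℤ; 0ℤ; 1ℤ; _+_; -_; _≤_; _<_; +≤+; +<+; ∣_∣)
import Data.Integer as ℤ
import Data.Integer.Properties as ℤ
open import Data.Integer.Tactic.RingSolver using (solve-∀)
open import Data.List using (List; []; _∷_; _++_; map; length; filter; foldr; allFin; tabulate)
import Data.List as List
open import Data.List.Membership.Propositional using (find; lose) renaming (_∈_ to _∈ˡ_)
open import Data.List.Membership.Propositional.Properties using (∈-allFin; ∈-map⁺; ∈-++⁺ˡ; ∈-++⁺ʳ; ∈-filter⁺; ∈-filter⁻)
open import Data.List.Properties using (filter-notAll; tabulate-cong; tabulate-lookup)
open import Data.List.Relation.Binary.Permutation.Propositional using (_↭_; ↭-refl; ↭-reflexive; ↭-trans; prep; swap)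
open import Data.List.Relation.Binary.Permutation.Propositional.Properties using (↭-length; filter-↭)
open import Data.List.Relation.Binary.Pointwise using (Pointwise; []; _∷_)
open import Data.List.Relation.Unary.All using (All; []; _∷_)
import Data.List.Relation.Unary.All as All
open import Data.List.Relation.Unary.AllPairs using (AllPairs; []; _∷_)
import Data.List.Relation.Unary.AllPairs.Properties as AllPairs
open import Data.List.Relation.Unary.Any using (Any; here; there)
open import Data.Nat using (ℕ; zero; suc)
import Data.Nat as ℕ
import Data.Nat.Properties as ℕ
open import Data.Product using (Σ-syntax; ∃-syntax; ∃; _×_; _,_; proj₁; proj₂)
open import Data.Sum using (_⊎_; inj₁; inj₂; [_,_]′)
open import Data.Vec using (Vec; []; _∷_; lookup; _[_]≔_)
import Data.Vec.Properties as Vec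
open import Function using (_∘_; id; case_of_)
open import Induction.WellFounded using (Acc; acc)
open import Relation.Binary.Construct.Closure.ReflexiveTransitive using (Star; ε; _◅_; _◅◅_; reverse)
open import Relation.Binary.PropositionalEquality using (_≡_; _≢_; refl; sym; trans; cong; cong₂; subst; subst₂; module ≡-Reasoning)
open import Relation.Nullary using (¬_; Dec; yes; no; does; contradiction)
open import Relation.Nullary.Decidable using (¬?; _×-dec_; _⊎-dec_; decidable-stable)
open import Relation.Unary using (Decidable)
open import Defs

open Algebra.Properties.CommutativeMonoid.Sum ℤ.+-0-commutativeMonoid using (sum; sum-cong-≗; sum-replicate-zero; ∑-distrib-+; ∑-comm)

private
  variable
    n : ℕ

-- Integer inequalities

-- The form in which submodularity is used for uncrossing: a lower bound on one of the two left-hand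
-- values becomes an upper bound on the other.
cancel-≤ : ∀ {a b c d} → a + b ≤ c + d → c ≤ a → b ≤ d
cancel-≤ {a} {b} {c} {d} p q = ℤ.≮⇒≥ λ d<b → ℤ.<⇒≱ (ℤ.+-mono-≤-< q d<b) p

cancel-< : ∀ {a b c d} → a + b ≤ c + d → c < a → b < d
cancel-< {a} {b} {c} {d} p q = ℤ.≰⇒> λ d≤b → ℤ.<⇒≱ (ℤ.+-mono-<-≤ q d≤b) p

cancelʳ-≤ : ∀ {a b c d} → a + b ≤ c + d → d ≤ b → a ≤ c
cancelʳ-≤ {a} {b} {c} {d} p = cancel-≤ (subst₂ _≤_ (ℤ.+-comm a b) (ℤ.+-comm c d) p)

≰⇒suc≤ : ∀ {i j} → ¬ i ≤ j → ℤ.suc j ≤ i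
≰⇒suc≤ = ℤ.i<j⇒suc[i]≤j ∘ ℤ.≰⇒>

<suc : ∀ i → i < ℤ.suc i
<suc i = ℤ.suc[i]≤j⇒i<j ℤ.≤-refl

≤<-absurd : ∀ {A : Set} {i j} → i ≤ j → j < i → A
≤<-absurd p q = contradiction p (ℤ.<⇒≱ q)

-- Sums over Fin

sum-mono-≤ : ∀ {f g : Fin n → ℤ} → (∀ i → f i ≤ g i) → sum f ≤ sum g
sum-mono-≤ {zero} p = ℤ.≤-refl
sum-mono-≤ {suc n} p = ℤ.+-mono-≤ (p zero) (sum-mono-≤ (p ∘ suc))

sum-mono-< : ∀ {f g : Fin n → ℤ} → (∀ i → f i ≤ g i) → ∀ j → f j < g j → sum f < sum g
sum-mono-< p zero q = ℤ.+-mono-<-≤ q (sum-mono-≤ (p ∘ suc))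
sum-mono-< p (suc j) q = ℤ.+-mono-≤-< (p zero) (sum-mono-< (p ∘ suc) j q)

sum-zero : ∀ {f : Fin n → ℤ} → (∀ i → f i ≡ 0ℤ) → sum f ≡ 0ℤ
sum-zero {n} p = trans (sum-cong-≗ p) (sum-replicate-zero n)

sum-single : ∀ {f : Fin n → ℤ} j → (∀ i → i ≢ j → f i ≡ 0ℤ) → sum f ≡ f j
sum-single {f = f} zero p = trans (cong (f zero +_) (sum-zero λ i → p (suc i) λ ())) (ℤ.+-identityʳ _)
sum-single {f = f} (suc j) p =
  trans (cong₂ _+_ (p zero λ ()) (sum-single {f = f ∘ suc} j λ i i≢j → p (suc i) (i≢j ∘ Fin.suc-injective)))
        (ℤ.+-identityˡ _)

sum-neg : ∀ (f : Fin n → ℤ) → sum (λ i → - f i) ≡ - sum f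
sum-neg {zero} f = refl
sum-neg {suc n} f = trans (cong (- f zero +_) (sum-neg (f ∘ suc))) (sym (ℤ.neg-distrib-+ (f zero) _))

-- Subsets

subset-ext : ∀ {X Y : Subset n} → (∀ i → lookup X i ≡ lookup Y i) → X ≡ Y
subset-ext {X = X} {Y} p = trans (sym (Vec.tabulate∘lookup X)) (trans (Vec.tabulate-cong p) (Vec.tabulate∘lookup Y))

∈⇒true : ∀ {v} {X : Subset n} → v ∈ X → lookup X v ≡ true
∈⇒true = Vec.[]=⇒lookup

∉⇒false : ∀ {v} {X : Subset n} → v ∉ X → lookup X v ≡ false
∉⇒false {v = v} {X} v∉X with lookup X v in eq
... | true = contradiction (Vec.lookup⇒[]= v X eq) v∉X
... | false = refl

lookup-∩ : ∀ (X Y : Subset n) i → lookup (X ∩ Y) i ≡ lookup X i ∧ lookup Y i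
lookup-∩ X Y i = Vec.lookup-zipWith _∧_ i X Y

lookup-∪ : ∀ (X Y : Subset n) i → lookup (X ∪ Y) i ≡ lookup X i ∨ lookup Y i
lookup-∪ X Y i = Vec.lookup-zipWith _∨_ i X Y

lookup-∁ : ∀ (X : Subset n) i → lookup (∁ X) i ≡ not (lookup X i)
lookup-∁ X i = Vec.lookup-map i not X

lookup-─ : ∀ (X Y : Subset n) i → lookup (X ─ Y) i ≡ lookup X i ∧ not (lookup Y i)
lookup-─ (x ∷ X) (true ∷ Y) zero with x
... | true = refl
... | false = refl
lookup-─ (x ∷ X) (false ∷ Y) zero with x
... | true = refl
... | false = refl
lookup-─ (x ∷ X) (y ∷ Y) (suc i) = lookup-─ X Y i

∁-involutive : ∀ (X : Subset n) → ∁ (∁ X) ≡ X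
∁-involutive X = subset-ext λ i → trans (lookup-∁ (∁ X) i) (trans (cong not (lookup-∁ X i)) (not-not (lookup X i)))
  where
  not-not : ∀ b → not (not b) ≡ b
  not-not true = refl
  not-not false = refl

∁-∩ : ∀ (X Y : Subset n) → ∁ (X ∩ Y) ≡ ∁ X ∪ ∁ Y
∁-∩ X Y = subset-ext λ i →
  trans (lookup-∁ (X ∩ Y) i) (trans (cong not (lookup-∩ X Y i))
  (trans (deMorgan (lookup X i) (lookup Y i))
  (sym (trans (lookup-∪ (∁ X) (∁ Y) i) (cong₂ _∨_ (lookup-∁ X i) (lookup-∁ Y i))))))
  where
  deMorgan : ∀ a b → not (a ∧ b) ≡ not a ∨ not b
  deMorgan true b = refl
  deMorgan false b = refl

─-as-∩ : ∀ (X Y : Subset n) → X ─ Y ≡ X ∩ ∁ Y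
─-as-∩ X Y = subset-ext λ i → trans (lookup-─ X Y i) (sym (trans (lookup-∩ X (∁ Y) i) (cong (lookup X i ∧_) (lookup-∁ Y i))))

∁-∪ : ∀ (X Y : Subset n) → ∁ (X ∪ Y) ≡ ∁ X ∩ ∁ Y
∁-∪ X Y = begin
  ∁ (X ∪ Y)               ≡⟨ cong₂ (λ P Q → ∁ (P ∪ Q)) (sym (∁-involutive X)) (sym (∁-involutive Y)) ⟩
  ∁ (∁ (∁ X) ∪ ∁ (∁ Y))   ≡⟨ cong ∁ (sym (∁-∩ (∁ X) (∁ Y))) ⟩
  ∁ (∁ (∁ X ∩ ∁ Y))       ≡⟨ ∁-involutive _ ⟩
  ∁ X ∩ ∁ Y               ∎
  where open ≡-Reasoning

∁-─ : ∀ (X Y : Subset n) → ∁ (X ─ Y) ≡ Y ∪ ∁ X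
∁-─ X Y = begin
  ∁ (X ─ Y)       ≡⟨ cong ∁ (─-as-∩ X Y) ⟩
  ∁ (X ∩ ∁ Y)     ≡⟨ ∁-∩ X (∁ Y) ⟩
  ∁ X ∪ ∁ (∁ Y)   ≡⟨ cong (∁ X ∪_) (∁-involutive Y) ⟩
  ∁ X ∪ Y         ≡⟨ ∪-comm (∁ X) Y ⟩
  Y ∪ ∁ X         ∎
  where open ≡-Reasoning

∈─⁺ : ∀ {v} {X Y : Subset n} → v ∈ X → v ∉ Y → v ∈ X ─ Y
∈─⁺ = x∈p∧x∉q⇒x∈p─q

∈─⁻ : ∀ {v} {X Y : Subset n} → v ∈ X ─ Y → v ∈ X × v ∉ Y
∈─⁻ {v = v} {X} {Y} p with subst (v ∈_) (─-as-∩ X Y) p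
... | q with x∈p∩q⁻ X (∁ Y) q
... | a , b = a , x∈∁p⇒x∉p b

⊈⇒∃ : ∀ {X Y : Subset n} → ¬ X ⊆ Y → Nonempty (X ─ Y)
⊈⇒∃ {X = X} {Y} X⊈Y with nonempty? (X ─ Y)
... | yes p = p
... | no ¬p = contradiction (λ {x} x∈X → decidable-stable (x ∈? Y) λ x∉Y → ¬p (x , ∈─⁺ x∈X x∉Y)) X⊈Y

-- Minimality is phrased as X ⊆ Y for every smaller Y, so that a vertex of X missing from Y is at
-- once a contradiction.
minimalSubset : ∀ {P : Subset n → Set} → Decidable P → ∃ P →
  ∃[ X ] P X × (∀ {Y} → P Y → Y ⊆ X → X ⊆ Y)
minimalSubset {n} {P} P? (X , PX) = go X (⊂-wellFounded X) PX
  where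
  go : ∀ X → Acc _⊂_ X → P X → ∃[ X ] P X × (∀ {Y} → P Y → Y ⊆ X → X ⊆ Y)
  go X (acc rs) PX with anySubset? (λ Y → P? Y ×-dec (Y ⊂? X))
  ... | yes (Y , PY , Y⊂X) = go Y (rs Y⊂X) PY
  ... | no none = X , PX , λ {Y} PY Y⊆X → decidable-stable (X ⊆? Y) λ X⊈Y →
    let (x , x∈) = ⊈⇒∃ X⊈Y in none (Y , PY , Y⊆X , x , ∈─⁻ x∈)

-- Modular functions

pick : Bool → ℤ → ℤ
pick b x = if b then x else 0ℤ

wt : (Fin n → ℤ) → Subset n → ℤ
wt d X = sum (λ v → pick (lookup X v) (d v))

ι : Fin n → Subset n → ℤ
ι v X = pick (lookup X v) 1ℤ

χ : Fin n → Fin n → ℤ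
χ u v with u Fin.≟ v
... | yes _ = 1ℤ
... | no _ = 0ℤ

χ-refl : ∀ (u : Fin n) → χ u u ≡ 1ℤ
χ-refl u with u Fin.≟ u
... | yes _ = refl
... | no u≢u = contradiction refl u≢u

χ-≢ : ∀ {u v : Fin n} → u ≢ v → χ u v ≡ 0ℤ
χ-≢ {u = u} {v} u≢v with u Fin.≟ v
... | yes u≡v = contradiction u≡v u≢v
... | no _ = refl

ι-∈ : ∀ {v} {X : Subset n} → v ∈ X → ι v X ≡ 1ℤ
ι-∈ v∈X rewrite ∈⇒true v∈X = refl

ι-∉ : ∀ {v} {X : Subset n} → v ∉ X → ι v X ≡ 0ℤ
ι-∉ v∉X rewrite ∉⇒false v∉X = refl

pick-zero : ∀ b → pick b 0ℤ ≡ 0ℤ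
pick-zero true = refl
pick-zero false = refl

wt-χ : ∀ (u : Fin n) X → wt (χ u) X ≡ ι u X
wt-χ u X = trans
  (sum-single u λ v v≢u → trans (cong (pick (lookup X v)) (χ-≢ (v≢u ∘ sym))) (pick-zero (lookup X v)))
  (cong (pick (lookup X u)) (χ-refl u))

wt-cong : ∀ {c d : Fin n → ℤ} → (∀ v → c v ≡ d v) → ∀ X → wt c X ≡ wt d X
wt-cong p X = sum-cong-≗ λ v → cong (pick (lookup X v)) (p v)

wt-+ : ∀ (c d : Fin n → ℤ) X → wt (λ v → c v + d v) X ≡ wt c X + wt d X
wt-+ c d X = trans (sum-cong-≗ λ v → pick-+ (lookup X v)) (∑-distrib-+ (λ v → pick (lookup X v) (c v)) (λ v → pick (lookup X v) (d v)))
  where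
  pick-+ : ∀ b {x y} → pick b (x + y) ≡ pick b x + pick b y
  pick-+ true = refl
  pick-+ false = refl

wt-neg : ∀ (d : Fin n → ℤ) X → wt (λ v → - d v) X ≡ - wt d X
wt-neg d X = trans (sum-cong-≗ λ v → pick-neg (lookup X v)) (sum-neg (λ v → pick (lookup X v) (d v)))
  where
  pick-neg : ∀ b {x} → pick b (- x) ≡ - pick b x
  pick-neg true = refl
  pick-neg false = refl

wt-modular : ∀ (d : Fin n → ℤ) X Y → wt d (X ∩ Y) + wt d (X ∪ Y) ≡ wt d X + wt d Y
wt-modular d X Y = begin
  wt d (X ∩ Y) + wt d (X ∪ Y)
    ≡⟨ sym (∑-distrib-+ (λ v → pick (lookup (X ∩ Y) v) (d v)) (λ v → pick (lookup (X ∪ Y) v) (d v))) ⟩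
  sum (λ v → pick (lookup (X ∩ Y) v) (d v) + pick (lookup (X ∪ Y) v) (d v))
    ≡⟨ sum-cong-≗ (λ v → trans (cong₂ (λ a b → pick a (d v) + pick b (d v)) (lookup-∩ X Y v) (lookup-∪ X Y v))
                               (table (lookup X v) (lookup Y v))) ⟩
  sum (λ v → pick (lookup X v) (d v) + pick (lookup Y v) (d v))
    ≡⟨ ∑-distrib-+ (λ v → pick (lookup X v) (d v)) (λ v → pick (lookup Y v) (d v)) ⟩
  wt d X + wt d Y ∎
  where
  open ≡-Reasoning
  table : ∀ a b {x} → pick (a ∧ b) x + pick (a ∨ b) x ≡ pick a x + pick b x
  table true true = refl
  table true false {x} = ℤ.+-comm 0ℤ x
  table false b = refl

wt-empty : ∀ (d : Fin n → ℤ) {X} → Empty X → wt d X ≡ 0ℤ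
wt-empty d {X} ∅ = sum-zero λ v → cong (λ b → pick b (d v)) (∉⇒false {X = X} λ v∈X → ∅ (v , v∈X))

wt-∪ : ∀ (d : Fin n → ℤ) X Y → Empty (X ∩ Y) → wt d (X ∪ Y) ≡ wt d X + wt d Y
wt-∪ d X Y ∅ = trans (sym (trans (cong (_+ wt d (X ∪ Y)) (wt-empty d ∅)) (ℤ.+-identityˡ _))) (wt-modular d X Y)

∩∁-empty : ∀ (X : Subset n) → Empty (X ∩ ∁ X)
∩∁-empty X (v , v∈) = let (a , b) = x∈p∩q⁻ X (∁ X) v∈ in x∈∁p⇒x∉p b a

wt-∁ : ∀ (d : Fin n → ℤ) → wt d ⊤ ≡ 0ℤ → ∀ X → wt d (∁ X) ≡ - wt d X
wt-∁ d p X = begin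
  wt d (∁ X)                        ≡⟨ lem (wt d X) (wt d (∁ X)) ⟩
  wt d X + wt d (∁ X) + - wt d X      ≡⟨ cong (_+ - wt d X) (sym (wt-∪ d X (∁ X) (∩∁-empty X))) ⟩
  wt d (X ∪ ∁ X) + - wt d X          ≡⟨ cong (λ Z → wt d Z + - wt d X) (p∪∁p≡⊤ X) ⟩
  wt d ⊤ + - wt d X                  ≡⟨ cong (_+ - wt d X) p ⟩
  0ℤ + - wt d X                     ≡⟨ ℤ.+-identityˡ _ ⟩
  - wt d X                          ∎
  where
  open ≡-Reasoning
  lem : ∀ a b → b ≡ a + b + - a
  lem = solve-∀

wt-⁅⁆ : ∀ (d : Fin n → ℤ) v → wt d ⁅ v ⁆ ≡ d v
wt-⁅⁆ d v = trans
  (sum-single v λ w w≢v → cong (λ b → pick b (d w)) (∉⇒false (x≢y⇒x∉⁅y⁆ w≢v)))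
  (cong (λ b → pick b (d v)) (∈⇒true (x∈⁅x⁆ v)))

-- Partitions of subsets

sumL : (Subset n → ℤ) → List (Subset n) → ℤ
sumL F [] = 0ℤ
sumL F (X ∷ L) = F X + sumL F L

sumL-mono-≤ : ∀ {F F′ : Subset n → ℤ} {L} → All (λ X → F X ≤ F′ X) L → sumL F L ≤ sumL F′ L
sumL-mono-≤ [] = ℤ.≤-refl
sumL-mono-≤ (p ∷ ps) = ℤ.+-mono-≤ p (sumL-mono-≤ ps)

sumL-mono-< : ∀ {F F′ : Subset n → ℤ} {L} → All (λ X → F X ≤ F′ X) L → Any (λ X → F X < F′ X) L →
  sumL F L < sumL F′ L
sumL-mono-< (_ ∷ ps) (here q) = ℤ.+-mono-<-≤ q (sumL-mono-≤ ps)
sumL-mono-< (p ∷ ps) (there q) = ℤ.+-mono-≤-< p (sumL-mono-< ps q)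

sumL-+ : ∀ (F F′ : Subset n → ℤ) L → sumL (λ X → F X + F′ X) L ≡ sumL F L + sumL F′ L
sumL-+ F F′ [] = refl
sumL-+ F F′ (X ∷ L) = trans (cong (_+_ (F X + F′ X)) (sumL-+ F F′ L)) (lem (F X) (F′ X) _ _)
  where
  lem : ∀ a b c d → a + b + (c + d) ≡ a + c + (b + d)
  lem = solve-∀

sumL-cong : ∀ {F F′ : Subset n → ℤ} → (∀ X → F X ≡ F′ X) → ∀ L → sumL F L ≡ sumL F′ L
sumL-cong p [] = refl
sumL-cong p (X ∷ L) = cong₂ _+_ (p X) (sumL-cong p L)

Disjoint : Subset n → Subset n → Set
Disjoint X Y = Empty (X ∩ Y)

-- Relative to a subset W, in contrast to `IsPartition`; when W misses a vertex, adding the part ∁ W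
-- gives a partition of the whole vertex set.
record Partitions (L : List (Subset n)) (W : Subset n) : Set where
  field
    nonempties : All Nonempty L
    disjoint   : AllPairs Disjoint L
    inside⊆    : All (_⊆ W) L
    covering   : ∀ {w} → w ∈ W → Any (w ∈_) L

wt-partition : ∀ (d : Fin n → ℤ) {L W} → Partitions L W → wt d W ≡ sumL (wt d) L
wt-partition d {L} {W} p = trans (cong (wt d) (⊆-antisym (λ w∈ → from (covering w∈)) (to inside⊆))) (go disjoint)
  where
  open Partitions p
  union : List (Subset _) → Subset _
  union = foldr _∪_ ⊥
  from : ∀ {w L} → Any (w ∈_) L → w ∈ union L
  from (here q) = x∈p∪q⁺ (inj₁ q)
  from (there q) = x∈p∪q⁺ (inj₂ (from q))
  to : ∀ {L} → All (_⊆ W) L → union L ⊆ W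
  to [] w∈ = contradiction w∈ ∉⊥
  to {X ∷ L} (q ∷ qs) w∈ = [ q , to qs ]′ (x∈p∪q⁻ X (union L) w∈)
  apart : ∀ {X L} → All (Disjoint X) L → Disjoint X (union L)
  apart {X} {[]} [] (w , w∈) = ∉⊥ (proj₂ (x∈p∩q⁻ X ⊥ w∈))
  apart {X} {Y ∷ L} (q ∷ qs) (w , w∈) with x∈p∩q⁻ X (Y ∪ union L) w∈
  ... | a , b = [ (λ c → q (w , x∈p∩q⁺ (a , c))) , (λ c → apart qs (w , x∈p∩q⁺ (a , c))) ]′ (x∈p∪q⁻ Y (union L) b)
  go : ∀ {L} → AllPairs Disjoint L → wt d (union L) ≡ sumL (wt d) L
  go [] = wt-empty d λ (w , w∈) → ∉⊥ w∈
  go {X ∷ L} (q ∷ qs) = trans (wt-∪ d X (union L) (apart qs′)) (cong (wt d X +_) (go qs))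
    where qs′ = q

-- Merging overlapping members of a family

module _ (T : Subset n → Set)
  (T-∪ : ∀ {X Y} → T X → T Y → Nonempty (X ∩ Y) → T (X ∪ Y)) where

  private
    -- One pass suffices on a disjoint list: a member that is passed over is disjoint from X and
    -- from all later members, hence from whatever X grows into.
    insert : Subset n → List (Subset n) → List (Subset n)
    insert X [] = X ∷ []
    insert X (Y ∷ L) with nonempty? (X ∩ Y)
    ... | yes _ = insert (X ∪ Y) L
    ... | no _ = Y ∷ insert X L

    insert-T : ∀ {X L} → T X → All T L → All T (insert X L)
    insert-T {X} {[]} t [] = t ∷ []
    insert-T {X} {Y ∷ L} t (s ∷ ts) with nonempty? (X ∩ Y)
    ... | yes ne = insert-T (T-∪ t s ne) ts
    ... | no _ = s ∷ insert-T t ts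

    insert-⊇ˡ : ∀ {w X} L → w ∈ X → Any (w ∈_) (insert X L)
    insert-⊇ˡ [] p = here p
    insert-⊇ˡ {X = X} (Y ∷ L) p with nonempty? (X ∩ Y)
    ... | yes _ = insert-⊇ˡ L (x∈p∪q⁺ (inj₁ p))
    ... | no _ = there (insert-⊇ˡ L p)

    insert-⊇ʳ : ∀ {w} X {L} → Any (w ∈_) L → Any (w ∈_) (insert X L)
    insert-⊇ʳ X {Y ∷ L} p with nonempty? (X ∩ Y)
    insert-⊇ʳ X {Y ∷ L} (here p) | yes _ = insert-⊇ˡ L (x∈p∪q⁺ (inj₂ p))
    insert-⊇ʳ X {Y ∷ L} (there p) | yes _ = insert-⊇ʳ (X ∪ Y) p
    insert-⊇ʳ X {Y ∷ L} (here p) | no _ = here p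
    insert-⊇ʳ X {Y ∷ L} (there p) | no _ = there (insert-⊇ʳ X p)

    disjoint-∪ : ∀ {Z X Y : Subset n} → Disjoint Z X → Disjoint Z Y → Disjoint Z (X ∪ Y)
    disjoint-∪ {Z} {X} {Y} p q (w , w∈) with x∈p∩q⁻ Z (X ∪ Y) w∈
    ... | a , b = [ (λ c → p (w , x∈p∩q⁺ (a , c))) , (λ c → q (w , x∈p∩q⁺ (a , c))) ]′ (x∈p∪q⁻ X Y b)

    disjoint-sym : ∀ {X Y : Subset n} → Disjoint X Y → Disjoint Y X
    disjoint-sym {X} {Y} p (w , w∈) = let (a , b) = x∈p∩q⁻ Y X w∈ in p (w , x∈p∩q⁺ (b , a))

    insert-apart : ∀ {Z X L} → Disjoint Z X → All (Disjoint Z) L → All (Disjoint Z) (insert X L)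
    insert-apart {L = []} p [] = p ∷ []
    insert-apart {X = X} {L = Y ∷ L} p (q ∷ qs) with nonempty? (X ∩ Y)
    ... | yes _ = insert-apart (disjoint-∪ p q) qs
    ... | no _ = q ∷ insert-apart p qs

    insert-disjoint : ∀ X {L} → AllPairs Disjoint L → AllPairs Disjoint (insert X L)
    insert-disjoint X {[]} [] = [] ∷ []
    insert-disjoint X {Y ∷ L} (p ∷ ps) with nonempty? (X ∩ Y)
    ... | yes _ = insert-disjoint (X ∪ Y) ps
    ... | no ∅ = insert-apart (disjoint-sym ∅) p ∷ insert-disjoint X ps

  -- Merging in one member of T through each point of W replaces the usual choice of the
  -- inclusion-maximal members.
  partitionOf : ∀ {W} → (∀ {X} → T X → Nonempty X × X ⊆ W) → (∀ {w} → w ∈ W → ∃[ X ] T X × w ∈ X) →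
    ∃[ L ] Partitions L W × All T L
  partitionOf {W} sub cov =
    let (L , ts , dis , c) = go (allFin n)
    in L , record { nonempties = All.map (proj₁ ∘ sub) ts ; disjoint = dis
                  ; inside⊆ = All.map (λ t {x} → proj₂ (sub t) {x}) ts ; covering = λ {w} → c w (∈-allFin w) } , ts
    where
    go : ∀ ws → ∃[ L ] All T L × AllPairs Disjoint L × (∀ w → w ∈ˡ ws → w ∈ W → Any (w ∈_) L)
    go [] = [] , [] , [] , λ _ ()
    go (x ∷ ws) with go ws | x ∈? W
    ... | L , ts , dis , c | no x∉W = L , ts , dis , λ where
      w (here refl) w∈W → contradiction w∈W x∉W
      w (there p) w∈W → c w p w∈W
    ... | L , ts , dis , c | yes x∈W with cov x∈W
    ... | X , t , x∈X = insert X L , insert-T t ts , insert-disjoint X dis , λ where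
      w (here refl) w∈W → insert-⊇ˡ L x∈X
      w (there p) w∈W → insert-⊇ʳ X (c w p w∈W)

-- Transfers of one unit between vertices

transfer : Fin n → Fin n → Fin n → ℤ
transfer v u w = χ u w + - χ v w

wt-transfer : ∀ (v u : Fin n) X → wt (transfer v u) X ≡ ι u X + - ι v X
wt-transfer v u X = trans (wt-+ (χ u) (λ w → - χ v w) X)
  (cong₂ _+_ (wt-χ u X) (trans (wt-neg (χ v) X) (cong -_ (wt-χ v X))))

wt-transfer-⊤ : ∀ (v u : Fin n) → wt (transfer v u) ⊤ ≡ 0ℤ
wt-transfer-⊤ v u = trans (wt-transfer v u ⊤)
  (cong₂ (λ a b → a + - b) (ι-∈ {v = u} {⊤} ∈⊤) (ι-∈ {v = v} {⊤} ∈⊤))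

-- The value at X goes down only if X contains v but not u, and then by exactly one, so strictness
-- is needed only there.
transfer-≥ : ∀ {a b} (v u : Fin n) X → a ≤ b → (v ∈ X → u ∉ X → a < b) → a ≤ b + (ι u X + - ι v X)
transfer-≥ {a = a} {b} v u X a≤b strict with v ∈? X | u ∈? X
... | yes v∈ | yes u∈ rewrite ι-∈ v∈ | ι-∈ u∈ | ℤ.+-identityʳ b = a≤b
... | no v∉ | no u∉ rewrite ι-∉ v∉ | ι-∉ u∉ | ℤ.+-identityʳ b = a≤b
... | no v∉ | yes u∈ rewrite ι-∉ v∉ | ι-∈ u∈ = ℤ.≤-trans a≤b (ℤ.i≤i+j b 1ℤ)
... | yes v∈ | no u∉ rewrite ι-∈ v∈ | ι-∉ u∉ =
  ℤ.≤-trans (ℤ.i<j⇒i≤pred[j] (strict v∈ u∉)) (ℤ.≤-reflexive (ℤ.+-comm ℤ.-1ℤ b))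

transfer-≥′ : ∀ {a b} (v u : Fin n) X → a ≤ b → (u ∈ X → v ∉ X → a < b) → a ≤ b + - (ι u X + - ι v X)
transfer-≥′ {b = b} v u X a≤b strict = subst (λ t → _ ≤ b + t) (lem (ι v X) (ι u X)) (transfer-≥ u v X a≤b strict)
  where
  lem : ∀ x y → x + - y ≡ - (y + - x)
  lem = solve-∀

_⊕_ _⊖_ : (Subset n → ℤ) → (Fin n → ℤ) → Subset n → ℤ
(F ⊕ d) X = F X + wt d X
(F ⊖ d) X = F X + - wt d X

-- F and G play the roles of the in- and out-degree function (or vice versa) on the sets avoiding the root r;
-- the last two laws are what partition-connectivity says about the partitions L ∪ {∁ W}.
record Laws (r : Fin n) (K : ℤ) (F G : Subset n → ℤ) : Set where
  field
    FF : ∀ X Y → F (X ∩ Y) + F (X ∪ Y) ≤ F X + F Y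
    GG : ∀ X Y → G (X ∩ Y) + G (X ∪ Y) ≤ G X + G Y
    FG : ∀ X Y → F (X ─ Y) + G (Y ─ X) ≤ F X + G Y
    PF : ∀ {L W} → Nonempty W → r ∉ W → Partitions L W → sumL (λ _ → K) L + K ≤ sumL F L + G W
    PG : ∀ {L W} → Nonempty W → r ∉ W → Partitions L W → sumL (λ _ → K) L + K ≤ sumL G L + F W

∩─-empty : ∀ (X Y : Subset n) → Disjoint (X ∩ Y) (X ─ Y)
∩─-empty X Y (w , w∈) = let (a , b) = x∈p∩q⁻ (X ∩ Y) (X ─ Y) w∈
                        in proj₂ (∈─⁻ {X = X} b) (proj₂ (x∈p∩q⁻ X Y a))

∩∪─ : ∀ (X Y : Subset n) → (X ∩ Y) ∪ (X ─ Y) ≡ X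
∩∪─ X Y = ⊆-antisym
  (λ w∈ → [ proj₁ ∘ x∈p∩q⁻ X Y , proj₁ ∘ ∈─⁻ {X = X} ]′ (x∈p∪q⁻ (X ∩ Y) (X ─ Y) w∈))
  (λ {w} w∈ → case w ∈? Y of λ where
    (yes w∈Y) → x∈p∪q⁺ (inj₁ (x∈p∩q⁺ (w∈ , w∈Y)))
    (no w∉Y) → x∈p∪q⁺ (inj₂ (∈─⁺ w∈ w∉Y)))

wt-split : ∀ (d : Fin n → ℤ) X Y → wt d X ≡ wt d (X ∩ Y) + wt d (X ─ Y)
wt-split d X Y = trans (cong (wt d) (sym (∩∪─ X Y))) (wt-∪ d (X ∩ Y) (X ─ Y) (∩─-empty X Y))

module _ {r : Fin n} {K : ℤ} {F G : Subset n → ℤ} where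

  Laws-swap : Laws r K F G → Laws r K G F
  Laws-swap l = record
    { FF = GG ; GG = FF ; PF = PG ; PG = PF
    ; FG = λ X Y → subst₂ _≤_ (ℤ.+-comm (F (Y ─ X)) _) (ℤ.+-comm (F Y) _) (FG Y X) }
    where open Laws l

  -- `FF` and `GG` gain the same modular amount on both sides. In `FG` the weight of X ∩ Y occurs
  -- with both signs. In `PF` and `PG` the weights of the parts of L add up to that of W, which
  -- enters with the opposite sign.
  Laws-shift : ∀ d → Laws r K F G → Laws r K (F ⊕ d) (G ⊖ d)
  Laws-shift d l = record
    { FF = λ X Y → subst₂ _≤_ (lem₁ (F (X ∩ Y)) (F (X ∪ Y)) (wt d (X ∩ Y)) (wt d (X ∪ Y))) (lem₁ (F X) (F Y) (wt d X) (wt d Y))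
        (ℤ.+-mono-≤ (FF X Y) (ℤ.≤-reflexive (wt-modular d X Y)))
    ; GG = λ X Y → subst₂ _≤_ (lem₂ (G (X ∩ Y)) (G (X ∪ Y)) (wt d (X ∩ Y)) (wt d (X ∪ Y))) (lem₂ (G X) (G Y) (wt d X) (wt d Y))
        (ℤ.+-mono-≤ (GG X Y) (ℤ.≤-reflexive (cong -_ (wt-modular d X Y))))
    ; FG = λ X Y → subst₂ _≤_ (lem₃ (F (X ─ Y)) (G (Y ─ X)) (wt d (X ─ Y)) (wt d (Y ─ X))) (fg X Y)
        (ℤ.+-mono-≤ (FG X Y) (ℤ.≤-refl {wt d (X ─ Y) + - wt d (Y ─ X)}))
    ; PF = λ {L} {W} ne r∉ p → subst (_ ≤_) (sym (trans
        (cong₂ _+_ (sumL-+ F (wt d) L) (cong (λ t → G W + - t) (wt-partition d p)))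
        (lem₄ (sumL F L) (G W) _))) (PF ne r∉ p)
    ; PG = λ {L} {W} ne r∉ p → subst (_ ≤_) (sym (trans
        (cong₂ _+_ (trans (sumL-+ G (λ X → - wt d X) L) (cong (sumL G L +_) (neg L)))
                   (cong (F W +_) (wt-partition d p)))
        (lem₅ (sumL G L) (F W) _))) (PG ne r∉ p)
    }
    where
    open Laws l
    lem₁ : ∀ a b c e → a + b + (c + e) ≡ a + c + (b + e)
    lem₁ = solve-∀
    lem₂ : ∀ a b c e → a + b + - (c + e) ≡ a + - c + (b + - e)
    lem₂ = solve-∀
    lem₃ : ∀ a b c e → a + b + (c + - e) ≡ a + c + (b + - e)
    lem₃ = solve-∀
    lem₄ : ∀ a b c → a + c + (b + - c) ≡ a + b
    lem₄ = solve-∀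
    lem₅ : ∀ a b c → a + - c + (b + c) ≡ a + b
    lem₅ = solve-∀
    lem₆ : ∀ a b i x y → a + b + (x + - y) ≡ a + (i + x) + (b + - (i + y))
    lem₆ = solve-∀
    fg : ∀ X Y → F X + G Y + (wt d (X ─ Y) + - wt d (Y ─ X)) ≡ F X + wt d X + (G Y + - wt d Y)
    fg X Y rewrite wt-split d X Y | wt-split d Y X | ∩-comm Y X = lem₆ (F X) (G Y) (wt d (X ∩ Y)) (wt d (X ─ Y)) (wt d (Y ─ X))
    neg : ∀ L → sumL (λ X → - wt d X) L ≡ - sumL (wt d) L
    neg [] = refl
    neg (X ∷ L) = trans (cong (- wt d X +_) (neg L)) (sym (ℤ.neg-distrib-+ (wt d X) _))

-- Raising the lower bound on G from k to k + 1 by transfers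

module Raise (r : Fin n) (k k′ : ℤ) (k′≤ : k′ ≤ ℤ.suc k) where

  K : ℤ
  K = ℤ.suc k

  Rooted : Subset n → Set
  Rooted X = Nonempty X × r ∉ X

  rooted? : Decidable Rooted
  rooted? X = nonempty? X ×-dec ¬? (r ∈? X)

  rooted-⊆ : ∀ {X Y} → Rooted Y → X ⊆ Y → Nonempty X → Rooted X
  rooted-⊆ (_ , r∉) X⊆Y ne = ne , r∉ ∘ X⊆Y

  rooted-∪ : ∀ {X Y} → Rooted X → Rooted Y → Rooted (X ∪ Y)
  rooted-∪ {X} {Y} ((w , w∈) , r∉X) (_ , r∉Y) = (w , x∈p∪q⁺ (inj₁ w∈)) , λ r∈ → [ r∉X , r∉Y ]′ (x∈p∪q⁻ X Y r∈)

  -- `k′` is the bound on F that must survive: k in the first round of `balance`, k + 1 in the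
  -- second. The set A on whose subsets G has been raised grows from ∅ to the whole vertex set.
  record State (A : Subset n) (F G : Subset n → ℤ) : Set where
    field
      laws : Laws r K F G
      F-lo : ∀ {X} → Rooted X → k′ ≤ F X
      G-lo : ∀ {X} → Rooted X → k ≤ G X
      G-hi : ∀ {X} → Rooted X → X ⊆ A → K ≤ G X

  Violator : Subset n → (Subset n → ℤ) → Subset n → Set
  Violator B G W = Rooted W × W ⊆ B × G W ≤ k

  violator? : ∀ B G → Decidable (Violator B G)
  violator? B G W = rooted? W ×-dec (W ⊆? B) ×-dec (G W ℤ.≤? k)

  module Move {A F G} (st : State A F G) (x : Fin n)
    (W : Subset n) (vW : Violator (A ∪ ⁅ x ⁆) G W)
    (minW : ∀ {Y} → Violator (A ∪ ⁅ x ⁆) G Y → Y ⊆ W → W ⊆ Y) where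

    open State st
    open Laws laws

    B : Subset n
    B = A ∪ ⁅ x ⁆

    -- No violator appears and W ceases to be one, so the number of violators drops; this drives the
    -- termination of `extend`.
    Improvement : Set
    Improvement = ∃[ v ] ∃[ u ] State A (F ⊕ transfer v u) (G ⊖ transfer v u)
      × (∀ {Y} → Violator B (G ⊖ transfer v u) Y → Violator B G Y)
      × ¬ Violator B (G ⊖ transfer v u) W

    B─x : ∀ {w} → w ∈ B → w ≢ x → w ∈ A
    B─x w∈B w≢x = [ id , (λ w∈x → contradiction (x∈⁅y⁆⇒x≡y x w∈x) w≢x) ]′ (x∈p∪q⁻ A ⁅ x ⁆ w∈B)

    rW : Rooted W
    rW = proj₁ vW

    W⊆B : W ⊆ B
    W⊆B = proj₁ (proj₂ vW)

    GW≤k : G W ≤ k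
    GW≤k = proj₂ (proj₂ vW)

    -- A set of low G-value inside B that missed x would lie in A, where G ≥ k + 1 already.
    low⇒x∈ : ∀ {Q} → Rooted Q → Q ⊆ B → G Q ≤ k → x ∈ Q
    low⇒x∈ {Q} rQ Q⊆B GQ≤k = decidable-stable (x ∈? Q) λ x∉Q →
      ≤<-absurd (G-hi rQ λ w∈ → B─x (Q⊆B w∈) λ { refl → x∉Q w∈ }) (ℤ.≤-<-trans GQ≤k (<suc k))

    x∈W : x ∈ W
    x∈W = low⇒x∈ rW W⊆B GW≤k

    -- F drops only on sets with v and without u, G only on sets with u and without v; the
    -- hypotheses supply the slack there, the last one so that no value k + 1 turns into a new
    -- violator. W contains v and not u, so its value rises.
    improve : ∀ v u → v ∈ W → u ∉ W →
      (∀ {X} → Rooted X → v ∈ X → u ∉ X → k′ < F X) →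
      (∀ {X} → Rooted X → u ∈ X → v ∉ X → k < G X) →
      (∀ {X} → Rooted X → X ⊆ A → u ∈ X → v ∉ X → K < G X) →
      (∀ {X} → Rooted X → X ⊆ B → u ∈ X → v ∉ X → K < G X) →
      Improvement
    improve v u v∈W u∉W f g h vio = v , u , record
      { laws = Laws-shift (transfer v u) laws
      ; F-lo = λ {X} rX → subst (λ t → k′ ≤ F X + t) (sym (wt-transfer v u X)) (transfer-≥ v u X (F-lo rX) (f rX))
      ; G-lo = λ rX → G-≥ rX (G-lo rX) (g rX)
      ; G-hi = λ {X} rX X⊆A → G-≥ rX (G-hi rX X⊆A) (h rX X⊆A) }
      , (λ {Y} (rY , Y⊆B , low) → rY , Y⊆B , ℤ.≮⇒≥ λ k<GY →
           ≤<-absurd low (ℤ.<-≤-trans (<suc k) (G-≥ rY (ℤ.i<j⇒suc[i]≤j k<GY) (vio rY Y⊆B))))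
      , λ (_ , _ , low) → ≤<-absurd low (ℤ.≤-<-trans (G-lo rW) raised)
      where
      G-≥ : ∀ {a X} → Rooted X → a ≤ G X → (u ∈ X → v ∉ X → a < G X) → a ≤ (G ⊖ transfer v u) X
      G-≥ {a} {X} rX a≤ s = subst (λ t → a ≤ G X + - t) (sym (wt-transfer v u X)) (transfer-≥′ v u X a≤ s)
      raised : G W < (G ⊖ transfer v u) W
      raised rewrite wt-transfer v u W | ι-∈ v∈W | ι-∉ u∉W = subst (G W <_) (ℤ.+-comm 1ℤ (G W)) (<suc (G W))

    FTight : Subset n → Set
    FTight X = Rooted X × F X ≤ k′

    fTight? : Decidable FTight
    fTight? X = rooted? X ×-dec (F X ℤ.≤? k′)

    FTight-∩ : ∀ {X Y} → FTight X → FTight Y → Nonempty (X ∩ Y) → FTight (X ∩ Y)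
    FTight-∩ {X} {Y} (rX , FX) (rY , FY) ne = rooted-⊆ rX (p∩q⊆p X Y) ne ,
      ℤ.≤-trans (cancelʳ-≤ (FF X Y) (ℤ.≤-trans FY (F-lo (rooted-∪ rX rY)))) FX

    FTight-∪ : ∀ {X Y} → FTight X → FTight Y → Nonempty (X ∩ Y) → FTight (X ∪ Y)
    FTight-∪ {X} {Y} (rX , FX) (rY , FY) ne = rooted-∪ rX rY ,
      ℤ.≤-trans (cancel-≤ (FF X Y) (ℤ.≤-trans FX (F-lo (rooted-⊆ rX (p∩q⊆p X Y) ne)))) FY

    -- The sets on which lowering G by one would break `G-lo` or `G-hi`.
    GTight : Subset n → Set
    GTight Q = Rooted Q × (G Q ≤ k ⊎ (Q ⊆ A × G Q ≤ K))

    gTight? : Decidable GTight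
    gTight? Q = rooted? Q ×-dec ((G Q ℤ.≤? k) ⊎-dec ((Q ⊆? A) ×-dec (G Q ℤ.≤? K)))

    -- If one of the two sets lies in A, so does the intersection, whose value is then at least k +
    -- 1. Hence the union of a set of the second kind with one of value k has value k again.
    GTight-∪ : ∀ {X Y} → GTight X → GTight Y → Nonempty (X ∩ Y) → GTight (X ∪ Y)
    GTight-∪ {X} {Y} (rX , tX) (rY , tY) ne = rooted-∪ rX rY , go tX tY
      where
      r∩ = rooted-⊆ rX (p∩q⊆p X Y) ne
      go : G X ≤ k ⊎ (X ⊆ A × G X ≤ K) → G Y ≤ k ⊎ (Y ⊆ A × G Y ≤ K) → G (X ∪ Y) ≤ k ⊎ (X ∪ Y ⊆ A × G (X ∪ Y) ≤ K)
      go (inj₂ (X⊆A , GX)) (inj₁ GY) =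
        inj₁ (ℤ.≤-trans (cancel-≤ (GG X Y) (ℤ.≤-trans GX (G-hi r∩ (X⊆A ∘ p∩q⊆p X Y)))) GY)
      go (inj₁ GX) (inj₁ GY) = inj₁ (ℤ.≤-trans (cancel-≤ (GG X Y) (ℤ.≤-trans GX (G-lo r∩))) GY)
      go (inj₁ GX) (inj₂ (Y⊆A , GY)) =
        inj₁ (ℤ.≤-trans (cancel-≤ (subst (G (X ∩ Y) + G (X ∪ Y) ≤_) (ℤ.+-comm (G X) (G Y)) (GG X Y))
                          (ℤ.≤-trans GY (G-hi r∩ (Y⊆A ∘ p∩q⊆q X Y)))) GX)
      go (inj₂ (X⊆A , GX)) (inj₂ (Y⊆A , GY)) =
        inj₂ ((λ w∈ → [ X⊆A , Y⊆A ]′ (x∈p∪q⁻ X Y w∈)) ,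
              ℤ.≤-trans (cancel-≤ (GG X Y) (ℤ.≤-trans GX (G-hi r∩ (X⊆A ∘ p∩q⊆p X Y)))) GY)

    InnerF : Fin n → Set
    InnerF w = ∃[ X ] FTight X × X ⊆ W × w ∈ X

    -- Otherwise F-tight sets partition W. Each part contributes at most k + 1 and G W at most k,
    -- which falls short of the bound `PF`.
    ¬covered-W : ¬ (∀ {w} → w ∈ W → InnerF w)
    ¬covered-W cov =
      let (L , part , ts) = partitionOf (λ X → FTight X × X ⊆ W)
            (λ {X} {Y} (tX , X⊆) (tY , Y⊆) ne → FTight-∪ tX tY ne , λ w∈ → [ X⊆ , Y⊆ ]′ (x∈p∪q⁻ X Y w∈))
            (λ (tX , X⊆) → proj₁ (proj₁ tX) , X⊆)
            (λ w∈ → let (X , tX , X⊆ , w∈X) = cov w∈ in X , (tX , X⊆) , w∈X)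
      in ≤<-absurd (PF (proj₁ rW) (proj₂ rW) part)
           (ℤ.+-mono-≤-< (sumL-mono-≤ {F = F} {λ _ → K} (All.map (λ t → ℤ.≤-trans (proj₂ (proj₁ t)) k′≤) ts))
                         (ℤ.≤-<-trans GW≤k (<suc k)))

    module _ (v : Fin n) (v∈W : v ∈ W) (¬inner : ¬ InnerF v)
      (X₀ : Subset n) (tX₀ : FTight X₀) (v∈X₀ : v ∈ X₀)
      (minX₀ : ∀ {Y} → FTight Y × v ∈ Y → Y ⊆ X₀ → X₀ ⊆ Y) where

      FX₀≤ : F X₀ ≤ k′
      FX₀≤ = proj₂ tX₀

      rX₀ : Rooted X₀
      rX₀ = proj₁ tX₀

      -- `FG` for X₀ and W: X₀ is not inside W by the choice of v, so F (X₀ ─ W) ≥ k′. This makes W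
      -- ─ X₀, if nonempty, a violator, but it misses v ∈ W, against the minimality of W.
      W⊆X₀ : W ⊆ X₀
      W⊆X₀ {w} w∈W = decidable-stable (w ∈? X₀) λ w∉X₀ →
        let rD = rooted-⊆ rW (p─q⊆p W X₀) (w , ∈─⁺ w∈W w∉X₀)
            rE = rooted-⊆ rX₀ (p─q⊆p X₀ W) (⊈⇒∃ λ X₀⊆W → ¬inner (X₀ , tX₀ , X₀⊆W , v∈X₀))
            low = ℤ.≤-trans (cancel-≤ (FG X₀ W) (ℤ.≤-trans FX₀≤ (F-lo rE))) GW≤k
            W⊆D = minW (rD , W⊆B ∘ p─q⊆p W X₀ , low) (p─q⊆p W X₀)
        in proj₂ (∈─⁻ {X = W} (W⊆D v∈W)) v∈X₀

      InnerG : Fin n → Set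
      InnerG w = ∃[ Q ] GTight Q × Q ⊆ X₀ × w ∈ Q

      -- The same count with `PG`. The deficit now comes from the part containing x: as x ∉ A, that
      -- part is tight with value k rather than k + 1.
      ¬covered-X₀ : ¬ (∀ {w} → w ∈ X₀ → InnerG w)
      ¬covered-X₀ cov =
        let (L , part , ts) = partitionOf (λ Q → GTight Q × Q ⊆ X₀)
              (λ {X} {Y} (tX , X⊆) (tY , Y⊆) ne → GTight-∪ tX tY ne , λ w∈ → [ X⊆ , Y⊆ ]′ (x∈p∪q⁻ X Y w∈))
              (λ (tX , X⊆) → proj₁ (proj₁ tX) , X⊆)
              (λ w∈ → let (X , tX , X⊆ , w∈X) = cov w∈ in X , (tX , X⊆) , w∈X)
        in ≤<-absurd (PG (proj₁ rX₀) (proj₂ rX₀) part)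
             (ℤ.+-mono-<-≤ (sumL-mono-< {F = G} {λ _ → K} (All.map (λ t → ≤K (proj₂ (proj₁ t))) ts)
                              (strict ts (Partitions.covering part (W⊆X₀ x∈W))))
                           (ℤ.≤-trans FX₀≤ k′≤))
        where
        ≤K : ∀ {Q} → G Q ≤ k ⊎ (Q ⊆ A × G Q ≤ K) → G Q ≤ K
        ≤K (inj₁ p) = ℤ.≤-trans p (ℤ.i≤suc[i] k)
        ≤K (inj₂ (_ , p)) = p
        x∉A : x ∉ A
        x∉A x∈A = ≤<-absurd (G-hi rW λ {w} w∈ → case w Fin.≟ x of λ where
          (yes refl) → x∈A
          (no w≢x) → B─x (W⊆B w∈) w≢x) (ℤ.≤-<-trans GW≤k (<suc k))
        strict : ∀ {L} → All (λ Q → GTight Q × Q ⊆ X₀) L → Any (x ∈_) L → Any (λ Q → G Q < K) L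
        strict (((_ , inj₁ p) , _) ∷ ts) (here x∈) = here (ℤ.≤-<-trans p (<suc k))
        strict (((_ , inj₂ (Q⊆A , _)) , _) ∷ ts) (here x∈) = contradiction (Q⊆A x∈) x∉A
        strict (_ ∷ ts) (there q) = there (strict ts q)

      module _ (u : Fin n) (u∈X₀ : u ∈ X₀) (¬innerG : ¬ InnerG u) where

        u∉W : u ∉ W
        u∉W u∈W = ¬innerG (W , (rW , inj₁ GW≤k) , W⊆X₀ , u∈W)

        -- An F-tight set with v and without u would meet X₀ in a smaller F-tight set containing v.
        F-strict : ∀ {X} → Rooted X → v ∈ X → u ∉ X → k′ < F X
        F-strict {X} rX v∈X u∉X = ℤ.≰⇒> λ FX≤ →
          let v∈∩ = x∈p∩q⁺ (v∈X , v∈X₀)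
              t∩ = FTight-∩ (rX , FX≤) tX₀ (v , v∈∩)
          in u∉X (p∩q⊆p X X₀ (minX₀ (t∩ , v∈∩) (p∩q⊆q X X₀) u∈X₀))

        -- X₀ ─ Q contains v but not u, so by the minimality of X₀ it is not F-tight; `FG` passes
        -- this strictness on to Q.
        G-drop : ∀ {Q} → Rooted Q → u ∈ Q → v ∉ Q → G (Q ─ X₀) < G Q
        G-drop {Q} rQ u∈Q v∉Q = cancel-< (FG X₀ Q) (ℤ.≤-<-trans FX₀≤ (ℤ.≰⇒> λ FD≤ →
          let v∈D = ∈─⁺ v∈X₀ v∉Q
          in proj₂ (∈─⁻ {X = X₀} (minX₀ ((rooted-⊆ rX₀ (p─q⊆p X₀ Q) (v , v∈D) , FD≤) , v∈D) (p─q⊆p X₀ Q) u∈X₀)) u∈Q))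

        -- Inside X₀ this is the choice of u. Otherwise Q ─ X₀ is nonempty, and `G-drop` pushes its
        -- value below the bound that `State` guarantees.
        ¬gTight : ∀ {Q} → u ∈ Q → v ∉ Q → ¬ GTight Q
        ¬gTight {Q} u∈Q v∉Q (rQ , tQ) with Q ⊆? X₀
        ... | yes Q⊆X₀ = ¬innerG (Q , (rQ , tQ) , Q⊆X₀ , u∈Q)
        ... | no Q⊈X₀ = go tQ
          where
          drop = G-drop rQ u∈Q v∉Q
          rD = rooted-⊆ rQ (p─q⊆p Q X₀) (⊈⇒∃ Q⊈X₀)
          go : ¬ (G Q ≤ k ⊎ (Q ⊆ A × G Q ≤ K))
          go (inj₁ p) = ≤<-absurd (G-lo rD) (ℤ.<-≤-trans drop p)
          go (inj₂ (Q⊆A , p)) = ≤<-absurd (G-hi rD (Q⊆A ∘ p─q⊆p Q X₀)) (ℤ.<-≤-trans drop p)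

        -- Inside A the set would be G-tight. Otherwise it contains x. If it is not inside X₀, then
        -- Q ─ X₀ lies in A and has too small a value. If it is inside X₀, then Q ∩ W misses v and
        -- is no violator, so uncrossing with W makes Q ∪ W a G-tight subset of X₀ through u.
        ¬newViolator : ∀ {Q} → Rooted Q → Q ⊆ B → u ∈ Q → v ∉ Q → K < G Q
        ¬newViolator {Q} rQ Q⊆B u∈Q v∉Q = ℤ.≰⇒> λ GQ≤K → absurd GQ≤K (Q ⊆? A) (Q ⊆? X₀)
          where
          absurd : G Q ≤ K → Dec (Q ⊆ A) → Dec (Q ⊆ X₀) → _
          absurd GQ≤K (yes Q⊆A) _ = ¬gTight u∈Q v∉Q (rQ , inj₂ (Q⊆A , GQ≤K))
          absurd GQ≤K (no _) (no Q⊈X₀) =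
            ≤<-absurd (G-hi (rooted-⊆ rQ (p─q⊆p Q X₀) (⊈⇒∃ Q⊈X₀)) D⊆A) (ℤ.<-≤-trans (G-drop rQ u∈Q v∉Q) GQ≤K)
            where
            D⊆A : Q ─ X₀ ⊆ A
            D⊆A w∈ = let (w∈Q , w∉X₀) = ∈─⁻ {X = Q} w∈ in B─x (Q⊆B w∈Q) λ { refl → w∉X₀ (W⊆X₀ x∈W) }
          absurd GQ≤K (no Q⊈A) (yes Q⊆X₀) = ¬innerG (Q ∪ W ,
            (rooted-∪ rQ rW , inj₁ (ℤ.≤-trans (cancel-≤ (GG Q W) (ℤ.≤-trans GQ≤K K≤)) GW≤k)) ,
            (λ w∈ → [ Q⊆X₀ , W⊆X₀ ]′ (x∈p∪q⁻ Q W w∈)) , x∈p∪q⁺ (inj₁ u∈Q))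
            where
            x∈Q : x ∈ Q
            x∈Q = decidable-stable (x ∈? Q) λ x∉Q → Q⊈A λ w∈ → B─x (Q⊆B w∈) λ { refl → x∉Q w∈ }
            K≤ : K ≤ G (Q ∩ W)
            K≤ = ≰⇒suc≤ λ low → v∉Q (p∩q⊆p Q W (minW
              (rooted-⊆ rQ (p∩q⊆p Q W) (x , x∈p∩q⁺ (x∈Q , x∈W)) , Q⊆B ∘ p∩q⊆p Q W , low) (p∩q⊆q Q W) v∈W))

        improvement₁ : Improvement
        improvement₁ = improve v u v∈W u∉W F-strict
          (λ rX u∈ v∉ → ℤ.≰⇒> λ p → ¬gTight u∈ v∉ (rX , inj₁ p))
          (λ rX X⊆A u∈ v∉ → ℤ.≰⇒> λ p → ¬gTight u∈ v∉ (rX , inj₂ (X⊆A , p)))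
          ¬newViolator

    improvement : Improvement
    improvement with Fin.any? (λ v → (v ∈? W) ×-dec ¬? (innerF? v))
      where
      innerF? : Decidable InnerF
      innerF? w = anySubset? λ X → fTight? X ×-dec (X ⊆? W) ×-dec (w ∈? X)
    ... | no none = contradiction (λ {w} w∈W → decidable-stable (anySubset? λ X → fTight? X ×-dec (X ⊆? W) ×-dec (w ∈? X))
                                     λ ¬inner → none (w , w∈W , ¬inner)) ¬covered-W
    ... | yes (v , v∈W , ¬inner) with anySubset? (λ X → fTight? X ×-dec (v ∈? X))
    -- With no F-tight set at v the unit may go to the root: rooted sets never contain r, so G does
    -- not drop on any of them.
    ... | no none = improve v r v∈W (proj₂ rW)
            (λ {X} rX v∈X _ → ℤ.≰⇒> λ p → none (X , (rX , p) , v∈X))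
            (λ rX r∈ _ → contradiction r∈ (proj₂ rX))
            (λ rX _ r∈ _ → contradiction r∈ (proj₂ rX))
            (λ rX _ r∈ _ → contradiction r∈ (proj₂ rX))
    ... | yes some with minimalSubset (λ X → fTight? X ×-dec (v ∈? X)) some
    ... | X₀ , (tX₀ , v∈X₀) , minX₀ with Fin.any? (λ u → (u ∈? X₀) ×-dec ¬? (innerG? u))
      where
      innerG? : Decidable (InnerG v v∈W ¬inner X₀ tX₀ v∈X₀ minX₀)
      innerG? w = anySubset? λ Q → gTight? Q ×-dec (Q ⊆? X₀) ×-dec (w ∈? Q)
    ... | yes (u , u∈X₀ , ¬innerG) = improvement₁ v v∈W ¬inner X₀ tX₀ v∈X₀ minX₀ u u∈X₀ ¬innerG
    ... | no none = contradiction (λ {w} w∈ → decidable-stable (anySubset? λ Q → gTight? Q ×-dec (Q ⊆? X₀) ×-dec (w ∈? Q))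
                                     λ ¬inner → none (w , w∈ , ¬inner))
                      (¬covered-X₀ v v∈W ¬inner X₀ tX₀ v∈X₀ minX₀)

-- Accumulating the transfers

record Shifted (F G F′ G′ : Subset n → ℤ) : Set where
  field
    d     : Fin n → ℤ
    total : wt d ⊤ ≡ 0ℤ
    eqF   : ∀ X → F′ X ≡ F X + wt d X
    eqG   : ∀ X → G′ X ≡ G X + - wt d X

Shifted-refl : ∀ {F G : Subset n → ℤ} → Shifted F G F G
Shifted-refl {n} {F} {G} = record
  { d = λ _ → 0ℤ ; total = S0 ⊤
  ; eqF = λ X → sym (trans (cong (F X +_) (S0 X)) (ℤ.+-identityʳ (F X)))
  ; eqG = λ X → sym (trans (cong (λ t → G X + - t) (S0 X)) (ℤ.+-identityʳ (G X))) }
  where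
  S0 : ∀ X → wt (λ _ → 0ℤ) X ≡ 0ℤ
  S0 X = sum-zero λ v → pick-zero (lookup X v)

Shifted-trans : ∀ {F G F′ G′ F″ G″ : Subset n → ℤ} → Shifted F G F′ G′ → Shifted F′ G′ F″ G″ → Shifted F G F″ G″
Shifted-trans {F = F} {G} p q = record
  { d = λ v → p.d v + q.d v
  ; total = trans (wt-+ p.d q.d ⊤) (cong₂ _+_ p.total q.total)
  ; eqF = λ X → trans (q.eqF X) (trans (cong (_+ wt q.d X) (p.eqF X))
      (trans (ℤ.+-assoc (F X) (wt p.d X) (wt q.d X)) (cong (F X +_) (sym (wt-+ p.d q.d X)))))
  ; eqG = λ X → trans (q.eqG X) (trans (cong (_+ - wt q.d X) (p.eqG X))
      (trans (lem (G X) (wt p.d X) (wt q.d X)) (cong (λ t → G X + - t) (sym (wt-+ p.d q.d X))))) }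
  where
  module p = Shifted p
  module q = Shifted q
  lem : ∀ a b c → a + - b + - c ≡ a + - (b + c)
  lem = solve-∀

Shifted-swap : ∀ {F G F′ G′ : Subset n → ℤ} → Shifted F G F′ G′ → Shifted G F G′ F′
Shifted-swap {F = F} {G} p = record
  { d = λ v → - p.d v
  ; total = trans (wt-neg p.d ⊤) (cong -_ p.total)
  ; eqF = λ X → trans (p.eqG X) (cong (G X +_) (sym (wt-neg p.d X)))
  ; eqG = λ X → trans (p.eqF X) (cong (F X +_) (trans (sym (ℤ.neg-involutive (wt p.d X))) (cong -_ (sym (wt-neg p.d X))))) }
  where module p = Shifted p

allSubsets : ∀ n → List (Subset n)
allSubsets zero = [] ∷ []
allSubsets (suc n) = map (inside ∷_) (allSubsets n) ++ map (outside ∷_) (allSubsets n)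

∈-allSubsets : ∀ (X : Subset n) → X ∈ˡ allSubsets n
∈-allSubsets [] = here refl
∈-allSubsets {suc n} (true ∷ X) = ∈-++⁺ˡ (∈-map⁺ (inside ∷_) (∈-allSubsets X))
∈-allSubsets {suc n} (false ∷ X) = ∈-++⁺ʳ (map (inside ∷_) (allSubsets n)) (∈-map⁺ (outside ∷_) (∈-allSubsets X))

module _ (r : Fin n) (k k′ : ℤ) (k′≤ : k′ ≤ ℤ.suc k) where

  open Raise r k k′ k′≤

  Reaches : Subset n → (F G : Subset n → ℤ) → Set
  Reaches B F G = ∃[ F′ ] ∃[ G′ ] Shifted F G F′ G′ × State B F′ G′

  -- Termination: the list holds all remaining violators, starting from all subsets, and each move
  -- filters out at least W.
  extend : ∀ {A F G} x → State A F G → Reaches (A ∪ ⁅ x ⁆) F G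
  extend {A} x st₀ = go _ (allSubsets n) ℕ.≤-refl st₀ λ Y _ → ∈-allSubsets Y
    where
    B = A ∪ ⁅ x ⁆
    go : ∀ s {F G} L → length L ℕ.≤ s → State A F G → (∀ Y → Violator B G Y → Y ∈ˡ L) → Reaches B F G
    go s {F} {G} L len st vs with anySubset? (violator? B G)
    ... | no none = F , G , Shifted-refl , record
      { laws = laws ; F-lo = F-lo ; G-lo = G-lo
      ; G-hi = λ {X} rX X⊆B → ≰⇒suc≤ λ p → none (X , rX , X⊆B , p) }
      where open State st
    ... | yes some with minimalSubset (violator? B G) some
    go zero [] len st vs | yes some | W , vW , minW = case vs W vW of λ ()
    go (suc s) {F} {G} L len st vs | yes some | W , vW , minW
      with Move.improvement st x W vW (λ {Y} → minW {Y})
    ... | v , u , st′ , old , ¬vW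
      with go s (filter (violator? B (G ⊖ transfer v u)) L)
             (ℕ.≤-pred (ℕ.≤-trans (filter-notAll (violator? B (G ⊖ transfer v u)) L (lose (vs W vW) ¬vW)) len))
             st′ (λ Y vY → ∈-filter⁺ (violator? B (G ⊖ transfer v u)) (vs Y (old vY)) vY)
    ... | F′ , G′ , sh , st″ = F′ , G′ , Shifted-trans shift sh , st″
      where
      shift : Shifted F G (F ⊕ transfer v u) (G ⊖ transfer v u)
      shift = record { d = transfer v u ; total = wt-transfer-⊤ v u ; eqF = λ _ → refl ; eqG = λ _ → refl }

  extendAll : ∀ {F G} → State ⊥ F G → Reaches ⊤ F G
  extendAll {F} {G} st with go (allFin n)
    where
    go : ∀ xs → Reaches (foldr (λ x A → A ∪ ⁅ x ⁆) ⊥ xs) F G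
    go [] = F , G , Shifted-refl , st
    go (x ∷ xs) =
      let (F′ , G′ , sh , st′) = go xs
          (F″ , G″ , sh′ , st″) = extend x st′
      in F″ , G″ , Shifted-trans sh sh′ , st″
  ... | F′ , G′ , sh , st′ = F′ , G′ , sh , record
    { laws = laws ; F-lo = F-lo ; G-lo = G-lo ; G-hi = λ rX _ → G-hi rX λ {w} _ → covers (∈-allFin w) }
    where
    open State st′
    covers : ∀ {w xs} → w ∈ˡ xs → w ∈ foldr (λ x A → A ∪ ⁅ x ⁆) ⊥ xs
    covers {w} (here refl) = x∈p∪q⁺ (inj₂ (x∈⁅x⁆ w))
    covers (there p) = x∈p∪q⁺ (inj₁ (covers p))

-- First F is raised while G ≥ k is kept, then G while F ≥ k + 1 is kept.
balance : ∀ (r : Fin n) k {F G} → Laws r (ℤ.suc k) F G →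
  (∀ {X} → Nonempty X → r ∉ X → k ≤ F X) → (∀ {X} → Nonempty X → r ∉ X → k ≤ G X) →
  ∃[ F′ ] ∃[ G′ ] Shifted F G F′ G′ ×
    (∀ {X} → Nonempty X → r ∉ X → k < F′ X) × (∀ {X} → Nonempty X → r ∉ X → k < G′ X)
balance r k l F≥ G≥ =
  let open Raise.State
      (G₁ , F₁ , sh₁ , st₁) = extendAll r k k (ℤ.i≤suc[i] k) (record
        { laws = Laws-swap l ; F-lo = λ (ne , r∉) → G≥ ne r∉ ; G-lo = λ (ne , r∉) → F≥ ne r∉
        ; G-hi = λ ((_ , w∈) , _) X⊆⊥ → contradiction (X⊆⊥ w∈) ∉⊥ })
      (F₂ , G₂ , sh₂ , st₂) = extendAll r k (ℤ.suc k) ℤ.≤-refl (record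
        { laws = Laws-swap (laws st₁) ; F-lo = λ rX → G-hi st₁ rX ⊆⊤ ; G-lo = F-lo st₁
        ; G-hi = λ ((_ , w∈) , _) X⊆⊥ → contradiction (X⊆⊥ w∈) ∉⊥ })
  in F₂ , G₂ , Shifted-trans (Shifted-swap sh₁) sh₂
     , (λ ne r∉ → ℤ.suc[i]≤j⇒i<j (F-lo st₂ (ne , r∉)))
     , (λ ne r∉ → ℤ.suc[i]≤j⇒i<j (G-hi st₂ (ne , r∉) ⊆⊤))

-- In-degree functions of orientations

ind : ∀ {P : Set} → Dec P → ℤ
ind P? = pick (does P?) 1ℤ

ind-≥0 : ∀ {P : Set} (P? : Dec P) → 0ℤ ≤ ind P?
ind-≥0 (yes _) = +≤+ ℕ.z≤n
ind-≥0 (no _) = ℤ.≤-refl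

ind-yes : ∀ {P : Set} (P? : Dec P) → P → ind P? ≡ 1ℤ
ind-yes (yes _) p = refl
ind-yes (no ¬p) p = contradiction p ¬p

ind-no : ∀ {P : Set} (P? : Dec P) → ¬ P → ind P? ≡ 0ℤ
ind-no (yes p) ¬p = contradiction p ¬p
ind-no (no _) _ = refl

ind-≤ : ∀ {P : Set} {x} (P? : Dec P) → 0ℤ ≤ x → (P → 1ℤ ≤ x) → ind P? ≤ x
ind-≤ (yes p) _ f = f p
ind-≤ (no _) q _ = q

ind-mono : ∀ {P Q : Set} (P? : Dec P) (Q? : Dec Q) → (P → Q) → ind P? ≤ ind Q?
ind-mono (no _) Q? f = ind-≥0 Q?
ind-mono (yes p) Q? f = ℤ.≤-reflexive (sym (ind-yes Q? (f p)))

ind-cong : ∀ {P Q : Set} (P? : Dec P) (Q? : Dec Q) → (P → Q) → (Q → P) → ind P? ≡ ind Q?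
ind-cong P? Q? f g = ℤ.≤-antisym (ind-mono P? Q? f) (ind-mono Q? P? g)

pick-sum : ∀ {e} b (f : Fin e → ℤ) → pick b (sum f) ≡ sum (λ i → pick b (f i))
pick-sum true f = refl
pick-sum false f = sym (sum-zero {f = λ i → pick false (f i)} λ _ → refl)

module Orientation {n e : ℕ} (Z : Fin e → Subset n) where

  Heads : Set
  Heads = Vec (Fin n) e

  record Valid (h : Heads) : Set where
    constructor valid
    field head∈ : ∀ i → lookup h i ∈ Z i

  open Valid

  inner : Subset n → ℤ
  inner X = sum λ i → ind (Z i ⊆? X)

  headCount : Heads → Fin n → ℤ
  headCount h w = sum λ i → χ (lookup h i) w

  F : Heads → Subset n → ℤ
  F h X = wt (headCount h) X + - inner X

  enters? : ∀ h X i → Dec (lookup h i ∈ X × ¬ Z i ⊆ X)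
  enters? h X i = (lookup h i ∈? X) ×-dec ¬? (Z i ⊆? X)

  wt-headCount : ∀ h X → wt (headCount h) X ≡ sum (λ i → ι (lookup h i) X)
  wt-headCount h X = begin
    sum (λ v → pick (lookup X v) (sum λ i → χ (lookup h i) v))
      ≡⟨ sum-cong-≗ (λ v → pick-sum (lookup X v) (λ i → χ (lookup h i) v)) ⟩
    sum (λ v → sum λ i → pick (lookup X v) (χ (lookup h i) v))
      ≡⟨ ∑-comm (λ v i → pick (lookup X v) (χ (lookup h i) v)) ⟩
    sum (λ i → wt (χ (lookup h i)) X)
      ≡⟨ sum-cong-≗ (λ i → wt-χ (lookup h i) X) ⟩
    sum (λ i → ι (lookup h i) X) ∎
    where open ≡-Reasoning

  -- By validity a hyperedge inside X has its head in X, so subtracting `inner` from the heads in X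
  -- leaves the hyperedges that enter X.
  F-count : ∀ {h} → Valid h → ∀ X → F h X ≡ sum (λ i → ind (enters? h X i))
  F-count {h} val X = begin
    wt (headCount h) X + - inner X
      ≡⟨ cong₂ _+_ (wt-headCount h X) (sym (sum-neg (λ i → ind (Z i ⊆? X)))) ⟩
    sum (λ i → ι (lookup h i) X) + sum (λ i → - ind (Z i ⊆? X))
      ≡⟨ sym (∑-distrib-+ (λ i → ι (lookup h i) X) (λ i → - ind (Z i ⊆? X))) ⟩
    sum (λ i → ι (lookup h i) X + - ind (Z i ⊆? X))
      ≡⟨ sum-cong-≗ each ⟩
    sum (λ i → ind (enters? h X i)) ∎
    where
    open ≡-Reasoning
    each : ∀ i → ι (lookup h i) X + - ind (Z i ⊆? X) ≡ ind (enters? h X i)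
    each i with lookup h i ∈? X | Z i ⊆? X
    ... | yes p | yes q rewrite ι-∈ p = refl
    ... | yes p | no q rewrite ι-∈ p = refl
    ... | no p | yes q = contradiction (q (head∈ val i)) p
    ... | no p | no q rewrite ι-∉ p = refl

  inner-supermodular : ∀ X Y → inner X + inner Y ≤ inner (X ∩ Y) + inner (X ∪ Y)
  inner-supermodular X Y = subst₂ _≤_ (∑-distrib-+ (λ i → ind (Z i ⊆? X)) (λ i → ind (Z i ⊆? Y)))
    (∑-distrib-+ (λ i → ind (Z i ⊆? (X ∩ Y))) (λ i → ind (Z i ⊆? (X ∪ Y)))) (sum-mono-≤ each)
    where
    each : ∀ i → ind (Z i ⊆? X) + ind (Z i ⊆? Y) ≤ ind (Z i ⊆? (X ∩ Y)) + ind (Z i ⊆? (X ∪ Y))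
    each i with Z i ⊆? X | Z i ⊆? Y
    ... | yes p | yes q
      rewrite ind-yes (Z i ⊆? (X ∩ Y)) (λ z∈ → x∈p∩q⁺ (p z∈ , q z∈))
            | ind-yes (Z i ⊆? (X ∪ Y)) (λ z∈ → x∈p∪q⁺ (inj₁ (p z∈))) = ℤ.≤-refl
    ... | yes p | no _ rewrite ind-yes (Z i ⊆? (X ∪ Y)) (λ z∈ → x∈p∪q⁺ (inj₁ (p z∈))) =
      ℤ.+-monoˡ-≤ 1ℤ (ind-≥0 (Z i ⊆? (X ∩ Y)))
    ... | no _ | yes q rewrite ind-yes (Z i ⊆? (X ∪ Y)) (λ z∈ → x∈p∪q⁺ (inj₂ (q z∈))) =
      ℤ.+-monoˡ-≤ 1ℤ (ind-≥0 (Z i ⊆? (X ∩ Y)))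
    ... | no _ | no _ = ℤ.+-mono-≤ (ind-≥0 (Z i ⊆? (X ∩ Y))) (ind-≥0 (Z i ⊆? (X ∪ Y)))

  F-submodular : ∀ h X Y → F h (X ∩ Y) + F h (X ∪ Y) ≤ F h X + F h Y
  F-submodular h X Y = subst₂ _≤_
    (lem (s (X ∩ Y)) (s (X ∪ Y)) (inner (X ∩ Y)) (inner (X ∪ Y))) (lem (s X) (s Y) (inner X) (inner Y))
    (ℤ.+-mono-≤ (ℤ.≤-reflexive (wt-modular (headCount h) X Y)) (ℤ.neg-mono-≤ (inner-supermodular X Y)))
    where
    s = wt (headCount h)
    lem : ∀ a b c d → a + b + - (c + d) ≡ a + - c + (b + - d)
    lem = solve-∀

  F-shift : ∀ {h h′} d → (∀ w → headCount h′ w ≡ headCount h w + d w) → ∀ X → F h′ X ≡ F h X + wt d X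
  F-shift {h} {h′} d p X = trans (cong (_+ - inner X) (trans (wt-cong p X) (wt-+ (headCount h) d X)))
    (lem (wt (headCount h) X) (wt d X) (inner X))
    where
    lem : ∀ a b c → a + b + - c ≡ a + - c + b
    lem = solve-∀

  headCount-update : ∀ h i u w → headCount (h [ i ]≔ u) w ≡ headCount h w + transfer (lookup h i) u w
  headCount-update h i u w = begin
    sum f′                        ≡⟨ lem (sum f′) (sum f) ⟩
    sum f + (sum f′ + - sum f)    ≡⟨ cong (λ t → sum f + (sum f′ + t)) (sym (sum-neg f)) ⟩
    sum f + (sum f′ + sum (λ j → - f j))  ≡⟨ cong (sum f +_) (sym (∑-distrib-+ f′ (λ j → - f j))) ⟩
    sum f + sum (λ j → f′ j + - f j)      ≡⟨ cong (sum f +_) (sum-single i λ j j≢i →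
        trans (cong (λ t → χ t w + - f j) (Vec.lookup∘update′ j≢i h u)) (ℤ.+-inverseʳ (f j))) ⟩
    sum f + (f′ i + - f i)                ≡⟨ cong (λ t → sum f + (χ t w + - f i)) (Vec.lookup∘update i h u) ⟩
    sum f + (χ u w + - χ (lookup h i) w)  ∎
    where
    open ≡-Reasoning
    f f′ : Fin e → ℤ
    f j = χ (lookup h j) w
    f′ j = χ (lookup (h [ i ]≔ u) j) w
    lem : ∀ a b → a ≡ b + (a + - b)
    lem = solve-∀

  Valid-update : ∀ {h i u} → Valid h → u ∈ Z i → Valid (h [ i ]≔ u)
  Valid-update {h} {i} {u} val u∈ = valid go
    where
    go : ∀ j → lookup (h [ i ]≔ u) j ∈ Z j
    go j with j Fin.≟ i
    ... | yes refl rewrite Vec.lookup∘update i h u = u∈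
    ... | no j≢i rewrite Vec.lookup∘update′ j≢i h u = head∈ val j

  -- Directed from a vertex of the hyperedge to its head; flipping it moves the head from y back to
  -- x.
  Arc : Heads → Fin n → Fin n → Set
  Arc h x y = ∃[ i ] lookup h i ≡ y × x ∈ Z i

  arc? : ∀ h x y → Dec (Arc h x y)
  arc? h x y = Fin.any? λ i → (lookup h i Fin.≟ y) ×-dec (x ∈? Z i)

  F-mono : ∀ {h X Y} → Valid h →
    (∀ i → lookup h i ∈ X → ¬ Z i ⊆ X → lookup h i ∈ Y × ¬ Z i ⊆ Y) → F h X ≤ F h Y
  F-mono {h} {X} {Y} val p = subst₂ _≤_ (sym (F-count val X)) (sym (F-count val Y))
    (sum-mono-≤ λ i → ind-mono (enters? h X i) (enters? h Y i) λ (a , b) → p i a b)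

  -- A hyperedge entering A has no vertex in N ─ A, so its vertices outside A lie outside N and it
  -- enters N too.
  F-noArcInto : ∀ {h A N} → Valid h → A ⊆ N → (∀ {x y} → x ∈ N → x ∉ A → y ∈ A → ¬ Arc h x y) → F h A ≤ F h N
  F-noArcInto {h} {A} {N} val A⊆N none = F-mono val λ i h∈A Z⊈A → A⊆N h∈A , λ Z⊆N →
    let (z , z∈) = ⊈⇒∃ Z⊈A
        (z∈Z , z∉A) = ∈─⁻ {X = Z i} z∈
    in none (Z⊆N z∈Z) z∉A h∈A (i , refl , z∈Z)

  -- These values are out-degrees. A hyperedge leaving A cannot have its head in N ─ A, so its head
  -- is outside N and it leaves N too.
  F-noArcOut : ∀ {h A N} → Valid h → A ⊆ N → (∀ {x y} → x ∈ A → y ∈ N → y ∉ A → ¬ Arc h x y) →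
    F h (∁ A) ≤ F h (∁ N)
  F-noArcOut {h} {A} {N} val A⊆N none = F-mono val λ i h∈∁A Z⊈∁A →
    let (z , z∈) = ⊈⇒∃ Z⊈∁A
        (z∈Z , z∉∁A) = ∈─⁻ {X = Z i} z∈
        z∈A = x∉∁p⇒x∈p z∉∁A
    in x∉p⇒x∈∁p (λ h∈N → none z∈A h∈N (x∈∁p⇒x∉p h∈∁A) (i , refl , z∈Z))
     , λ Z⊆∁N → x∈∁p⇒x∉p (Z⊆∁N z∈Z) (A⊆N z∈A)

  -- Partition-connectivity

  crossing : List (Subset n) → ℤ
  crossing P = sum λ i → ind (2 ℕ.≤? partsMet P (Z i))

  -- Of two disjoint parts that are met, at most one contains h; the other is returned.
  twoMet : ∀ {P} (W : Subset n) h → AllPairs Disjoint P → 2 ℕ.≤ partsMet P W →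
    ∃[ Y ] Y ∈ˡ P × Nonempty (W ∩ Y) × h ∉ Y
  twoMet {P} W h dis two with filter meets? P in eq
    where
    meets? : Decidable (λ X → Nonempty (W ∩ X))
    meets? X = nonempty? (W ∩ X)
  twoMet W h dis (ℕ.s≤s ()) | Y ∷ []
  twoMet {P} W h dis two | Y ∷ Y′ ∷ L with AllPairs.filter⁺ (λ X → nonempty? (W ∩ X)) dis
  ... | dis′ rewrite eq with dis′
  ... | (Y∩Y′ ∷ _) ∷ _ with h ∈? Y
  ... | no h∉Y = let (a , b) = ∈-filter⁻ (λ X → nonempty? (W ∩ X)) {xs = P} (subst (Y ∈ˡ_) (sym eq) (here refl)) in Y , a , b , h∉Y
  ... | yes h∈Y =
    let (a , b) = ∈-filter⁻ (λ X → nonempty? (W ∩ X)) {xs = P} (subst (Y′ ∈ˡ_) (sym eq) (there (here refl)))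
    in Y′ , a , b , λ h∈Y′ → Y∩Y′ (h , x∈p∩q⁺ (h∈Y , h∈Y′))

  member-disjoint : ∀ {P : List (Subset n)} {X Y} → AllPairs Disjoint P → X ∈ˡ P → Y ∈ˡ P → X ≡ Y ⊎ (∀ {w} → w ∈ X → w ∉ Y)
  member-disjoint (_ ∷ _) (here refl) (here refl) = inj₁ refl
  member-disjoint (p ∷ _) (here refl) (there q) = inj₂ λ a b → All.lookup p q (_ , x∈p∩q⁺ (a , b))
  member-disjoint (p ∷ _) (there q) (here refl) = inj₂ λ a b → All.lookup p q (_ , x∈p∩q⁺ (b , a))
  member-disjoint (_ ∷ ps) (there q) (there q′) = member-disjoint ps q q′

  sumL-sum : ∀ (f : Subset n → Fin e → ℤ) P → sumL (λ X → sum (f X)) P ≡ sum (λ i → sumL (λ X → f X i) P)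
  sumL-sum f [] = sym (sum-zero {e} {f = λ _ → 0ℤ} λ _ → refl)
  sumL-sum f (X ∷ P) = trans (cong (sum (f X) +_) (sumL-sum f P)) (sym (∑-distrib-+ (f X) (λ i → sumL (λ X → f X i) P)))

  sumL-≥0 : ∀ {f : Subset n → ℤ} → (∀ X → 0ℤ ≤ f X) → ∀ P → 0ℤ ≤ sumL f P
  sumL-≥0 p [] = ℤ.≤-refl
  sumL-≥0 p (X ∷ P) = ℤ.+-mono-≤ (p X) (sumL-≥0 p P)

  sumL-≥1 : ∀ {f : Subset n → ℤ} → (∀ X → 0ℤ ≤ f X) → ∀ {P Y} → Y ∈ˡ P → f Y ≡ 1ℤ → 1ℤ ≤ sumL f P
  sumL-≥1 {f} p {X ∷ P} (here refl) q rewrite q = ℤ.+-monoʳ-≤ 1ℤ (sumL-≥0 p P)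
  sumL-≥1 {f} p {X ∷ P} (there r) q = ℤ.+-mono-≤ (p X) (sumL-≥1 p r q)

  -- Each crossing hyperedge is counted by some summand. The map f is `id` for in-degrees and `∁`
  -- for out-degrees.
  crossing-bound : ∀ (f : Subset n → Subset n) {h P} → Valid h →
    (∀ i → 2 ℕ.≤ partsMet P (Z i) → ∃[ Y ] Y ∈ˡ P × lookup h i ∈ f Y × ¬ Z i ⊆ f Y) →
    crossing P ≤ sumL (λ X → F h (f X)) P
  crossing-bound f {h} {P} val p = subst (crossing P ≤_)
    (sym (trans (sumL-cong (λ X → F-count val (f X)) P) (sumL-sum (λ X i → ind (enters? h (f X) i)) P)))
    (sum-mono-≤ each)
    where
    each : ∀ i → ind (2 ℕ.≤? partsMet P (Z i)) ≤ sumL (λ X → ind (enters? h (f X) i)) P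
    each i = ind-≤ (2 ℕ.≤? partsMet P (Z i)) (sumL-≥0 (λ X → ind-≥0 (enters? h (f X) i)) P) λ two →
      let (Y , Y∈ , q) = p i two
      in sumL-≥1 (λ X → ind-≥0 (enters? h (f X) i)) Y∈ (ind-yes (enters? h (f Y) i) q)

  -- A crossing hyperedge leaves any part that it meets away from its head.
  crossing≤out : ∀ {h P} → Valid h → AllPairs Disjoint P → crossing P ≤ sumL (λ X → F h (∁ X)) P
  crossing≤out {h} {P} val dis = crossing-bound ∁ val λ i two →
    let (Y , Y∈ , (z , z∈) , h∉) = twoMet (Z i) (lookup h i) dis two
        (z∈Z , z∈Y) = x∈p∩q⁻ (Z i) Y z∈
    in Y , Y∈ , x∉p⇒x∈∁p h∉ , λ Z⊆ → x∈∁p⇒x∉p (Z⊆ z∈Z) z∈Y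

  -- A crossing hyperedge enters the part containing its head, since it also meets another one.
  crossing≤in : ∀ {h P} → Valid h → AllPairs Disjoint P → (∀ w → Any (w ∈_) P) → crossing P ≤ sumL (F h) P
  crossing≤in {h} {P} val dis cov = crossing-bound id val λ i two →
    let (Y , Y∈ , (z , z∈) , h∉) = twoMet (Z i) (lookup h i) dis two
        (z∈Z , z∈Y) = x∈p∩q⁻ (Z i) Y z∈
        (X , X∈ , h∈X) = find (cov (lookup h i))
    in X , X∈ , h∈X , λ Z⊆X → case member-disjoint dis X∈ Y∈ of λ where
         (inj₁ X≡Y) → h∉ (subst (lookup h i ∈_) X≡Y h∈X)
         (inj₂ apart) → apart (Z⊆X z∈Z) z∈Y

  module _ (K : ℤ) (conn : ∀ P → IsPartition P → 2 ℕ.≤ length P → sumL (λ _ → K) P ≤ crossing P)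
    (r : Fin n) {h : Heads} (val : Valid h) where

    private
      isPartition : ∀ {L W} → r ∉ W → Partitions L W → IsPartition (∁ W ∷ L)
      isPartition {L} {W} r∉ p = record
        { nonemptyParts = (r , x∉p⇒x∈∁p r∉) ∷ nonempties
        ; disjoint = All.map (λ {X} X⊆W (w , w∈) → let (a , b) = x∈p∩q⁻ (∁ W) X w∈ in x∈∁p⇒x∉p a (X⊆W b)) inside⊆ ∷ disjoint
        ; covers = λ v → case v ∈? W of λ where
            (yes v∈) → there (covering v∈)
            (no v∉) → here (x∉p⇒x∈∁p v∉) }
        where open Partitions p

      two≤ : ∀ {L} {W : Subset n} → Nonempty W → Partitions L W → 2 ℕ.≤ suc (length L)
      two≤ {[]} (w , w∈) p = case Partitions.covering p w∈ of λ ()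
      two≤ {_ ∷ _} _ _ = ℕ.s≤s (ℕ.s≤s ℕ.z≤n)

    -- `FG` is submodularity for X and ∁ Y, because X ∪ ∁ Y is the complement of Y ─ X. For `PF` and
    -- `PG` the part ∁ W is added to L, and in-degrees, respectively out-degrees, are summed over
    -- all parts.
    F-laws : Laws r K (F h) (λ X → F h (∁ X))
    F-laws = record
      { FF = F-submodular h
      ; GG = λ X Y → subst₂ _≤_
          (trans (ℤ.+-comm (F h (∁ X ∩ ∁ Y)) _) (sym (cong₂ (λ P Q → F h P + F h Q) (∁-∩ X Y) (∁-∪ X Y)))) refl
          (F-submodular h (∁ X) (∁ Y))
      ; FG = λ X Y → subst (_≤ F h X + F h (∁ Y))
          (sym (cong₂ (λ P Q → F h P + F h Q) (─-as-∩ X Y) (∁-─ Y X))) (F-submodular h X (∁ Y))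
      ; PF = λ {L} {W} ne r∉ p →
          let P = isPartition r∉ p
          in subst₂ _≤_ (ℤ.+-comm K (sumL (λ _ → K) L)) (ℤ.+-comm (F h (∁ W)) (sumL (F h) L))
               (ℤ.≤-trans (conn _ P (two≤ ne p)) (crossing≤in val (IsPartition.disjoint P) (IsPartition.covers P)))
      ; PG = λ {L} {W} ne r∉ p →
          let P = isPartition r∉ p
          in subst₂ _≤_ (ℤ.+-comm K (sumL (λ _ → K) L))
               (trans (cong (λ Y → F h Y + sumL (λ X → F h (∁ X)) L) (∁-involutive W)) (ℤ.+-comm (F h W) _))
               (ℤ.≤-trans (conn _ P (two≤ ne p)) (crossing≤out val (IsPartition.disjoint P)))
      }

-- The walk along which a unit is transferred

module Step {n : ℕ} (F : Subset n → ℤ) (FF : ∀ X Y → F (X ∩ Y) + F (X ∪ Y) ≤ F X + F Y)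
  (E : Fin n → Fin n → Set) (E? : ∀ x y → Dec (E x y))
  (noArcInto : ∀ {A N} → A ⊆ N → (∀ {x y} → x ∈ N → x ∉ A → y ∈ A → ¬ E x y) → F A ≤ F N)
  (noArcOut : ∀ {A N} → A ⊆ N → (∀ {x y} → x ∈ A → y ∈ N → y ∉ A → ¬ E x y) → F (∁ A) ≤ F (∁ N))
  (k : ℤ) (F∅≤k : F (∁ ⊤) ≤ k)
  (lo : ∀ {X} → Nonempty X → Nonempty (∁ X) → k ≤ F X)
  (d : Fin n → ℤ) (total : wt d ⊤ ≡ 0ℤ)
  (hi : ∀ {X} → Nonempty X → Nonempty (∁ X) → k < F X + wt d X)
  where

  Tight : Subset n → Set
  Tight X = (Nonempty X × Nonempty (∁ X)) × F X ≤ k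

  tight? : Decidable Tight
  tight? X = (nonempty? X ×-dec nonempty? (∁ X)) ×-dec (F X ℤ.≤? k)

  -- The target value F + wt d exceeds k, so a set of in-degree k still has to gain.
  tight-wt : ∀ {X} → Tight X → 0ℤ < wt d X
  tight-wt {X} ((ne , ne′) , FX≤k) = ℤ.≰⇒> λ S≤0 →
    ≤<-absurd (ℤ.≤-trans (ℤ.+-mono-≤ FX≤k S≤0) (ℤ.≤-reflexive (ℤ.+-identityʳ k))) (hi ne ne′)

  -- Moving one unit of in-degree from y to u keeps the in-degrees ≥ k exactly for such y.
  Free : Fin n → Fin n → Set
  Free u y = ¬ (∃[ T ] Tight T × y ∈ T × u ∉ T)

  free? : ∀ u y → Dec (Free u y)
  free? u y = ¬? (anySubset? λ T → tight? T ×-dec (y ∈? T) ×-dec ¬? (u ∈? T))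

  free-∈ : ∀ {u y T} → Free u y → Tight T → y ∈ T → u ∈ T
  free-∈ {u} {y} {T} f t y∈ = decidable-stable (u ∈? T) λ u∉ → f (T , t , y∈ , u∉)

  -- Freeness is required at every vertex reached, since after flipping the walk up to y the net
  -- effect is the transfer from y to u. The visited vertices are listed to keep them distinct.
  data Walk (u : Fin n) : List (Fin n) → Fin n → Set where
    start : Walk u (u ∷ []) u
    step  : ∀ {vs x y} → Walk u vs x → E x y → ¬ (y ∈ˡ vs) → Free u y → Walk u (y ∷ vs) y

  -- For N = V the last condition always holds, so a seed is then contained in every tight set. For
  -- a seed of a proper N, tight sets that avoid it and meet N stay within N, and unions of such
  -- sets are proper.
  Escaping : Subset n → Fin n → Subset n → Set
  Escaping N u T = Tight T × u ∉ T × Nonempty (T ∩ N) × ¬ (T ⊆ N × Nonempty (∁ N))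

  Seed : Subset n → Fin n → Set
  Seed N u = u ∈ N × 0ℤ < d u × ¬ ∃ (Escaping N u)

  seed? : ∀ N → Decidable (Seed N)
  seed? N u = (u ∈? N) ×-dec (0ℤ ℤ.<? d u) ×-dec ¬? (anySubset? λ T →
    tight? T ×-dec ¬? (u ∈? T) ×-dec nonempty? (T ∩ N) ×-dec ¬? ((T ⊆? N) ×-dec nonempty? (∁ N)))

  seed-⊆ : ∀ {N u T} → Seed N u → Tight T → u ∉ T → Nonempty (T ∩ N) → T ⊆ N × Nonempty (∁ N)
  seed-⊆ {N} {u} {T} (_ , _ , none) t u∉ ne =
    decidable-stable ((T ⊆? N) ×-dec nonempty? (∁ N)) λ q → none (T , t , u∉ , ne , q)

  -- Closing the set of reached vertices

  module Closure (N : Subset n) where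

    -- The walks stay inside A, so a vertex outside A has been visited by none of them and can be
    -- appended. Each vertex remembers the seed of its walk, because freeness depends on it.
    record Reached (A : Subset n) (src : Fin n → Fin n) : Set where
      field
        A⊆N   : A ⊆ N
        seeds : ∀ {w} → w ∈ A → Seed N (src w)
        walk  : ∀ {w} → w ∈ A → ∃[ vs ] Walk (src w) vs w × (∀ {z} → z ∈ˡ vs → z ∈ A)

    Closed : Subset n → (Fin n → Fin n) → Set
    Closed A src = (∀ {u} → Seed N u → u ∈ A) ×
      (∀ {x y} → x ∈ A → y ∈ N → y ∉ A → E x y → ¬ Free (src x) y)

    add : ∀ {A src u y vs} → Reached A src → y ∈ N → Seed N u →
      Walk u vs y → (∀ {z} → z ∈ˡ vs → z ∈ A ⊎ z ≡ y) → ∃[ src′ ] Reached (A ∪ ⁅ y ⁆) src′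
    add {A} {src} {u} {y} {vs} re y∈N sd wk vs⊆ = src′ , record
      { A⊆N = λ w∈ → [ A⊆N , (λ w∈y → subst (_∈ N) (sym (x∈⁅y⁆⇒x≡y y w∈y)) y∈N) ]′ (x∈p∪q⁻ A ⁅ y ⁆ w∈)
      ; seeds = seeds′ ; walk = walk′ }
      where
      open Reached re
      src′ : Fin n → Fin n
      src′ w with w Fin.≟ y
      ... | yes _ = u
      ... | no _ = src w
      old : ∀ {w} → w ∈ A ∪ ⁅ y ⁆ → w ≢ y → w ∈ A
      old w∈ w≢y = [ id , (λ w∈y → contradiction (x∈⁅y⁆⇒x≡y y w∈y) w≢y) ]′ (x∈p∪q⁻ A ⁅ y ⁆ w∈)
      seeds′ : ∀ {w} → w ∈ A ∪ ⁅ y ⁆ → Seed N (src′ w)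
      seeds′ {w} w∈ with w Fin.≟ y
      ... | yes _ = sd
      ... | no w≢y = seeds (old w∈ w≢y)
      walk′ : ∀ {w} → w ∈ A ∪ ⁅ y ⁆ → ∃[ vs ] Walk (src′ w) vs w × (∀ {z} → z ∈ˡ vs → z ∈ A ∪ ⁅ y ⁆)
      walk′ {w} w∈ with w Fin.≟ y
      ... | yes refl = vs , wk , λ z∈ → x∈p∪q⁺ ([ inj₁ , (λ { refl → inj₂ (x∈⁅x⁆ y) }) ]′ (vs⊆ z∈))
      ... | no w≢y = let (vs , wk , sub) = walk (old w∈ w≢y) in vs , wk , λ z∈ → x∈p∪q⁺ (inj₁ (sub z∈))

    close : ∀ A src → Acc _⊃_ A → Reached A src → ∃[ A ] ∃[ src ] Reached A src × Closed A src
    close A src (acc rs) re with Fin.any? (λ u → seed? N u ×-dec ¬? (u ∈? A))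
    ... | yes (u , sd , u∉A) =
      let (src′ , re′) = add re (proj₁ sd) sd start λ { (here z≡u) → inj₂ z≡u }
      in close (A ∪ ⁅ u ⁆) src′ (rs (p⊆p∪q ⁅ u ⁆ , u , x∈p∪q⁺ (inj₂ (x∈⁅x⁆ u)) , u∉A)) re′
    ... | no noSeed with Fin.any? (λ x → Fin.any? λ y →
            (x ∈? A) ×-dec (y ∈? N) ×-dec ¬? (y ∈? A) ×-dec E? x y ×-dec free? (src x) y)
    ... | yes (x , y , x∈A , y∈N , y∉A , e , fr) =
      let (vs , wk , sub) = Reached.walk re x∈A
          (src′ , re′) = add re y∈N (Reached.seeds re x∈A) (step wk e (y∉A ∘ sub) fr)
            λ { (here z≡y) → inj₂ z≡y ; (there z∈) → inj₁ (sub z∈) }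
      in close (A ∪ ⁅ y ⁆) src′ (rs (p⊆p∪q ⁅ y ⁆ , y , x∈p∪q⁺ (inj₂ (x∈⁅x⁆ y)) , y∉A)) re′
    ... | no noArc = A , src , re
      , (λ {u} sd → decidable-stable (u ∈? A) λ u∉A → noSeed (u , sd , u∉A))
      , λ {x} {y} x∈A y∈N y∉A e fr → noArc (x , y , x∈A , y∈N , y∉A , e , fr)

  -- What the closure argument needs of N. It covers both the case without tight sets, where N = V,
  -- and a minimal N around a tight set.
  record Region (N : Subset n) : Set where
    field
      F∁N≤k   : F (∁ N) ≤ k
      minimal : ∀ {A} → A ⊆ N → Nonempty A → F (∁ A) ≤ k → (∀ {T} → Tight T → T ⊆ N → T ⊆ A) → N ⊆ A
      seedIn  : ∀ {T} → Tight T → T ⊆ N → ∃[ u ] u ∈ T × Seed N u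
      aSeed   : ∃ (Seed N)

  Result : Set
  Result = ∃[ u ] ∃[ v ] ∃[ vs ] Walk u vs v × 0ℤ < d u × d v < 0ℤ

  module _ {N} (reg : Region N) where
    open Region reg
    open Closure N

    private
      closure = close ⊥ (λ _ → proj₁ aSeed) (⊃-wellFounded ⊥) (record
        { A⊆N = λ w∈ → contradiction w∈ ∉⊥ ; seeds = λ w∈ → contradiction w∈ ∉⊥ ; walk = λ w∈ → contradiction w∈ ∉⊥ })
      A = proj₁ closure
      src = proj₁ (proj₂ closure)
      open Reached (proj₁ (proj₂ (proj₂ closure)))
      seeds∈ = proj₁ (proj₂ (proj₂ (proj₂ closure)))
      closed = proj₂ (proj₂ (proj₂ (proj₂ closure)))

      Bad : Subset n → Set
      Bad T = Tight T × T ⊆ N × ¬ T ⊆ A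

      bad? : Decidable Bad
      bad? T = tight? T ×-dec (T ⊆? N) ×-dec ¬? (T ⊆? A)

      module _ {T} (bT : Bad T) (minT : ∀ {Y} → Bad Y → Y ⊆ T → T ⊆ Y) where

        tT = proj₁ bT
        T⊆N = proj₁ (proj₂ bT)

        -- As x lies in A and y does not, y is not free for the seed u of x: a tight Q contains y
        -- and misses u. Since u is a seed, Q ⊆ N and N is proper, so Q ∩ T is tight by uncrossing,
        -- hence bad, and minimality gives T ⊆ Q. But u ∈ T, since x is u itself or free for u.
        noArc : ∀ {x y} → x ∈ T → x ∉ T ─ A → y ∈ T ─ A → ¬ E x y
        noArc {x} {y} x∈T x∉D y∈D e = closed x∈A (T⊆N y∈T) y∉A e λ (Q , tQ , y∈Q , u∉Q) →
          let (Q⊆N , z , z∈∁N) = seed-⊆ (seeds x∈A) tQ u∉Q (y , x∈p∩q⁺ (y∈Q , T⊆N y∈T))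
              y∈∩ = x∈p∩q⁺ (y∈Q , y∈T)
              proper∩ = (y , y∈∩) , proj₁ (proj₂ (proj₁ tQ)) ,
                x∉p⇒x∈∁p (x∈∁p⇒x∉p (proj₂ (proj₂ (proj₁ tQ))) ∘ p∩q⊆p Q T)
              lo∪ = lo (y , x∈p∪q⁺ (inj₁ y∈Q))
                (z , x∉p⇒x∈∁p λ z∈ → x∈∁p⇒x∉p z∈∁N ([ Q⊆N , T⊆N ]′ (x∈p∪q⁻ Q T z∈)))
              F∩≤ = ℤ.≤-trans (cancelʳ-≤ (FF Q T) (ℤ.≤-trans (proj₂ tT) lo∪)) (proj₂ tQ)
              T⊆∩ = minT ((proper∩ , F∩≤) , T⊆N ∘ p∩q⊆q Q T , λ ∩⊆A → y∉A (∩⊆A y∈∩)) (p∩q⊆q Q T)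
          in u∉Q (p∩q⊆p Q T (T⊆∩ u∈T))
          where
          y∈T = proj₁ (∈─⁻ {X = T} y∈D)
          y∉A = proj₂ (∈─⁻ {X = T} y∈D)
          x∈A : x ∈ A
          x∈A = decidable-stable (x ∈? A) λ x∉A → x∉D (∈─⁺ x∈T x∉A)
          src-∈ : ∀ {vs} → Walk (src x) vs x → src x ∈ T
          src-∈ w with src x
          src-∈ start | _ = x∈T
          src-∈ (step _ _ _ fr) | _ = free-∈ fr tT x∈T
          u∈T : src x ∈ T
          u∈T = src-∈ (proj₁ (proj₂ (walk x∈A)))

        -- By `noArc` the set T ─ A has in-degree at most k and is itself bad, so T misses A by
        -- minimality. Yet T contains a seed, and all seeds are in A.
        absurd-bad : ∀ {P : Set} → P
        absurd-bad =
          let (w , w∈) = ⊈⇒∃ (proj₂ (proj₂ bT))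
              F≤ = ℤ.≤-trans (noArcInto (p─q⊆p T A) noArc) (proj₂ tT)
              (z , z∈) = proj₂ (proj₁ tT)
              T⊆D = minT ((((w , w∈) , z , x∉p⇒x∈∁p (x∈∁p⇒x∉p z∈ ∘ p─q⊆p T A)) , F≤) , T⊆N ∘ p─q⊆p T A ,
                          λ D⊆A → proj₂ (∈─⁻ {X = T} w∈) (D⊆A w∈)) (p─q⊆p T A)
              (u , u∈T , sd) = seedIn tT T⊆N
          in contradiction (seeds∈ sd) (proj₂ (∈─⁻ {X = T} (T⊆D u∈T)))

      tight⊆A : ∀ {T} → Tight T → T ⊆ N → T ⊆ A
      tight⊆A {T} tT T⊆N with anySubset? bad?
      ... | yes some = let (T′ , bT′ , minT′) = minimalSubset bad? some in absurd-bad bT′ (λ {Y} → minT′ {Y})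
      ... | no none = decidable-stable (T ⊆? A) λ T⊈A → none (T , tT , T⊆N , T⊈A)

      -- An arc from A to y ∈ N ─ A would yield a tight subset of N through y, which lies in A by
      -- `tight⊆A`. Without such arcs A inherits the low out-degree of N, and minimality applies.
      N⊆A : N ⊆ A
      N⊆A = minimal A⊆N (proj₁ aSeed , seeds∈ (proj₂ aSeed)) (ℤ.≤-trans (noArcOut A⊆N noArcA) F∁N≤k) tight⊆A
        where
        noArcA : ∀ {x y} → x ∈ A → y ∈ N → y ∉ A → ¬ E x y
        noArcA {x} {y} x∈A y∈N y∉A e = closed x∈A y∈N y∉A e λ (Q , tQ , y∈Q , u∉Q) →
          y∉A (tight⊆A tQ (proj₁ (seed-⊆ (seeds x∈A) tQ u∉Q (y , x∈p∩q⁺ (y∈Q , y∈N)))) y∈Q)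

      -- If N is proper, its complement is tight and therefore has positive weight, while the total
      -- is 0.
      wt-N≤0 : wt d N ≤ 0ℤ
      wt-N≤0 with nonempty? (∁ N)
      ... | no ∅ = ℤ.≤-reflexive (trans (cong (wt d) (⊆-antisym ⊆⊤ λ {w} _ → x∉∁p⇒x∈p λ w∈ → ∅ (w , w∈))) total)
      ... | yes ne = ℤ.<⇒≤ (ℤ.neg-cancel-< (subst (0ℤ <_) (wt-∁ d total N) (tight-wt ((ne , ne″) , F∁N≤k))))
        where
        ne″ : Nonempty (∁ (∁ N))
        ne″ = subst Nonempty (sym (∁-involutive N)) (proj₁ aSeed , proj₁ (proj₂ aSeed))

      -- N has weight at most 0 but contains a seed, whose entry is positive.
      negative : ∃[ v ] v ∈ N × d v < 0ℤ
      negative with Fin.any? (λ v → (v ∈? N) ×-dec (d v ℤ.<? 0ℤ))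
      ... | yes p = p
      ... | no none = ≤<-absurd wt-N≤0 (subst (_< wt d N) (sum-zero {n} {f = λ _ → 0ℤ} λ _ → refl)
                        (sum-mono-< each u (subst (0ℤ <_) (sym (cong (λ b → pick b (d u)) (∈⇒true u∈N))) 0<du)))
        where
        u = proj₁ aSeed
        u∈N = proj₁ (proj₂ aSeed)
        0<du = proj₁ (proj₂ (proj₂ aSeed))
        each : ∀ v → 0ℤ ≤ pick (lookup N v) (d v)
        each v with v ∈? N
        ... | yes v∈ rewrite ∈⇒true v∈ = ℤ.≮⇒≥ λ dv<0 → none (v , v∈ , dv<0)
        ... | no v∉ rewrite ∉⇒false v∉ = ℤ.≤-refl

    regionResult : Result
    regionResult =
      let (v , v∈N , dv<0) = negative
          v∈A = N⊆A v∈N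
          (vs , wk , _) = walk v∈A
      in src v , v , vs , wk , proj₁ (proj₂ (seeds v∈A)) , dv<0

  -- wt d is positive on M but not on the sets O, whose maximal members are disjoint.
  module _ {M} (tM : Tight M) where

    private
      Out : Subset n → Set
      Out O = (Nonempty O × O ⊆ M) × F (∁ O) ≤ k

      out? : Decidable Out
      out? O = (nonempty? O ×-dec (O ⊆? M)) ×-dec (F (∁ O) ℤ.≤? k)

      InOut : Fin n → Set
      InOut u = ∃[ O ] Out O × u ∈ O

      inOut? : Decidable InOut
      inOut? u = anySubset? λ O → out? O ×-dec (u ∈? O)

      outside-M : ∃[ z ] z ∉ M
      outside-M = let (z , z∈) = proj₂ (proj₁ tM) in z , x∈∁p⇒x∉p z∈

      out-tight : ∀ {O} → Out O → Tight (∁ O)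
      out-tight {O} ((ne , O⊆M) , low) =
        ((proj₁ outside-M , x∉p⇒x∈∁p (proj₂ outside-M ∘ O⊆M)) , subst Nonempty (sym (∁-involutive O)) ne) , low

      out-wt : ∀ {O} → Out O → wt d O ≤ 0ℤ
      out-wt {O} o = ℤ.<⇒≤ (ℤ.neg-cancel-< (subst (0ℤ <_) (wt-∁ d total O) (tight-wt (out-tight o))))

      out-∪ : ∀ {X Y} → Out X → Out Y → Nonempty (X ∩ Y) → Out (X ∪ Y)
      out-∪ {X} {Y} ((ne , X⊆M) , lX) ((_ , Y⊆M) , lY) (w , w∈) =
        ((proj₁ ne , x∈p∪q⁺ (inj₁ (proj₂ ne))) , λ z∈ → [ X⊆M , Y⊆M ]′ (x∈p∪q⁻ X Y z∈)) ,
        subst (λ Q → F Q ≤ k) (sym (∁-∪ X Y)) (ℤ.≤-trans (cancelʳ-≤ (FF (∁ X) (∁ Y)) (ℤ.≤-trans lY lo∪)) lX)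
        where
        w∈X = proj₁ (x∈p∩q⁻ X Y w∈)
        w∈Y = proj₂ (x∈p∩q⁻ X Y w∈)
        lo∪ : k ≤ F (∁ X ∪ ∁ Y)
        lo∪ = lo (proj₁ outside-M , x∈p∪q⁺ (inj₁ (x∉p⇒x∈∁p (proj₂ outside-M ∘ X⊆M))))
          (w , x∉p⇒x∈∁p λ w∈′ → [ x∈p⇒x∉∁p w∈X , x∈p⇒x∉∁p w∈Y ]′ (x∈p∪q⁻ (∁ X) (∁ Y) w∈′))

      -- Singletons with d ≤ 0 join the sets O, so that the pieces cover M if `excess` fails.
      Piece : Subset n → Set
      Piece X = Out X ⊎ (∃[ u ] u ∈ M × d u ≤ 0ℤ × X ≡ ⁅ u ⁆)

      absorb : ∀ {u} {X : Subset n} → u ∈ X → X ∪ ⁅ u ⁆ ≡ X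
      absorb {u} {X} u∈X = ⊆-antisym
        (λ w∈ → [ id , (λ w∈u → subst (_∈ X) (sym (x∈⁅y⁆⇒x≡y u w∈u)) u∈X) ]′ (x∈p∪q⁻ X ⁅ u ⁆ w∈)) (p⊆p∪q ⁅ u ⁆)

      piece-∪ : ∀ {X Y} → Piece X → Piece Y → Nonempty (X ∩ Y) → Piece (X ∪ Y)
      piece-∪ (inj₁ oX) (inj₁ oY) ne = inj₁ (out-∪ oX oY ne)
      piece-∪ {X} pX (inj₂ (u , _ , _ , refl)) (w , w∈) =
        let (a , b) = x∈p∩q⁻ X ⁅ u ⁆ w∈
        in subst Piece (sym (absorb (subst (_∈ X) (x∈⁅y⁆⇒x≡y u b) a))) pX
      piece-∪ {_} {Y} (inj₂ (u , _ , _ , refl)) pY (w , w∈) =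
        let (a , b) = x∈p∩q⁻ ⁅ u ⁆ Y w∈
        in subst Piece (sym (trans (∪-comm ⁅ u ⁆ Y) (absorb (subst (_∈ Y) (x∈⁅y⁆⇒x≡y u a) b)))) pY

      piece-⊆ : ∀ {X} → Piece X → Nonempty X × X ⊆ M
      piece-⊆ (inj₁ (p , _)) = p
      piece-⊆ (inj₂ (u , u∈M , _ , refl)) = (u , x∈⁅x⁆ u) , λ w∈ → subst (_∈ M) (sym (x∈⁅y⁆⇒x≡y u w∈)) u∈M

      piece-wt : ∀ {X} → Piece X → wt d X ≤ 0ℤ
      piece-wt (inj₁ o) = out-wt o
      piece-wt (inj₂ (u , _ , du≤0 , refl)) = subst (_≤ 0ℤ) (sym (wt-⁅⁆ d u)) du≤0

      sumL-0 : ∀ (L : List (Subset n)) → sumL (λ _ → 0ℤ) L ≡ 0ℤ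
      sumL-0 [] = refl
      sumL-0 (_ ∷ L) = trans (ℤ.+-identityˡ _) (sumL-0 L)

    -- Otherwise M splits into pieces of weight at most 0, whereas the tight set M has positive
    -- weight.
    excess : ∃[ u ] u ∈ M × 0ℤ < d u × (∀ {O} → Nonempty O → O ⊆ M → F (∁ O) ≤ k → u ∉ O)
    excess with Fin.any? (λ u → (u ∈? M) ×-dec (0ℤ ℤ.<? d u) ×-dec ¬? (inOut? u))
    ... | yes (u , u∈M , 0<du , none) = u , u∈M , 0<du , λ {O} ne O⊆M low u∈O → none (O , ((ne , O⊆M) , low) , u∈O)
    ... | no none =
      let (L , part , ps) = partitionOf Piece piece-∪ piece-⊆ cov
      in ≤<-absurd (subst₂ _≤_ (sym (wt-partition d part)) (sumL-0 L) (sumL-mono-≤ {F = wt d} {λ _ → 0ℤ} (All.map piece-wt ps)))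
           (tight-wt tM)
      where
      cov : ∀ {w} → w ∈ M → ∃[ X ] Piece X × w ∈ X
      cov {w} w∈M with inOut? w
      ... | yes (O , o , w∈O) = O , inj₁ o , w∈O
      ... | no ¬o = ⁅ w ⁆ , inj₂ (w , w∈M , ℤ.≮⇒≥ (λ 0<dw → none (w , w∈M , 0<dw , ¬o)) , refl) , x∈⁅x⁆ w

  -- A nonempty proper A with out-degree at most k would make ∁ A tight, and without tight sets
  -- every u with d u > 0 is a seed.
  trivialRegion : ¬ ∃ Tight → ∃[ u ] 0ℤ < d u → Region ⊤
  trivialRegion none (u , 0<du) = record
    { F∁N≤k = F∅≤k
    ; minimal = λ {A} _ ne low _ {w} _ → decidable-stable (w ∈? A) λ w∉A →
        none (∁ A , ((w , x∉p⇒x∈∁p w∉A) , subst Nonempty (sym (∁-involutive A)) ne) , low)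
    ; seedIn = λ {T} t _ → contradiction (T , t) none
    ; aSeed = u , ∈⊤ , 0<du , λ (T , t , _) → none (T , t) }

  module _ {N} (low : F (∁ N) ≤ k) (M₀ : Subset n) (tM₀ : Tight M₀) (M₀⊆N : M₀ ⊆ N)
    (minN : ∀ {Y} → F (∁ Y) ≤ k × (∃[ M ] Tight M × M ⊆ Y) → Y ⊆ N → N ⊆ Y) where

    private
      -- If Q ⊆ N, then N is everything and the complement of N ─ Q is Q itself. Otherwise Q and ∁ N
      -- are uncrossed; their intersection is nonempty and proper, so it has value at least k.
      low-─ : ∀ {Q} → Tight Q → ¬ (Q ⊆ N × Nonempty (∁ N)) → F (∁ (N ─ Q)) ≤ k
      low-─ {Q} ((_ , z , z∈) , FQ≤k) esc with Q ⊆? N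
      ... | yes Q⊆N = subst (λ Y → F Y ≤ k) (sym (trans (∁-─ N Q) Q∪∁N≡Q)) FQ≤k
        where
        Q∪∁N≡Q : Q ∪ ∁ N ≡ Q
        Q∪∁N≡Q = ⊆-antisym
          (λ {w} w∈ → [ id , (λ w∈∁N → ⊥-elim (esc (Q⊆N , w , w∈∁N))) ]′ (x∈p∪q⁻ Q (∁ N) w∈)) (p⊆p∪q (∁ N))
      ... | no Q⊈N = subst (λ Y → F Y ≤ k) (sym (∁-─ N Q))
        (ℤ.≤-trans (cancel-≤ (FF Q (∁ N)) (ℤ.≤-trans FQ≤k
          (lo (subst Nonempty (─-as-∩ Q N) (⊈⇒∃ Q⊈N))
              (z , x∉p⇒x∈∁p (x∈∁p⇒x∉p z∈ ∘ p∩q⊆p Q (∁ N)))))) low)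

      -- Take u from `excess` for a minimal tight M ⊆ T. If Q escapes, then D = N ─ Q has out-degree
      -- at most k and contains u. If M ⊆ D, then D contradicts the minimality of N; if D ⊆ M, it
      -- contradicts the choice of u; otherwise M ∩ ∁ D is tight and misses u, against the
      -- minimality of M.
      seedIn : ∀ {T} → Tight T → T ⊆ N → ∃[ u ] u ∈ T × Seed N u
      seedIn {T} tT T⊆N
        with minimalSubset (λ M → tight? M ×-dec (M ⊆? T)) (T , tT , id)
      ... | M , (tM , M⊆T) , minM with excess tM
      ... | u , u∈M , 0<du , u∉Out = u , M⊆T u∈M , T⊆N (M⊆T u∈M) , 0<du , λ (Q , tQ , u∉Q , (x , x∈) , esc) →
        absurd-esc tQ u∉Q (proj₁ (x∈p∩q⁻ Q N x∈)) (proj₂ (x∈p∩q⁻ Q N x∈)) esc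
        where
        absurd-esc : ∀ {Q x} → Tight Q → u ∉ Q → x ∈ Q → x ∈ N → ¬ ¬ (Q ⊆ N × Nonempty (∁ N))
        absurd-esc {Q} {x} tQ u∉Q x∈Q x∈N esc with nonempty? (M ─ (N ─ Q)) | (N ─ Q) ⊆? M
        ... | no ∅ | _ = proj₂ (∈─⁻ {X = N} (minN (low-─ tQ esc , M , tM , M⊆D) (p─q⊆p N Q) x∈N)) x∈Q
          where
          M⊆D : M ⊆ N ─ Q
          M⊆D {w} w∈ = decidable-stable (w ∈? (N ─ Q)) λ w∉ → ∅ (w , ∈─⁺ w∈ w∉)
        ... | yes _ | yes D⊆M = u∉Out (u , u∈D) D⊆M (low-─ tQ esc) u∈D
          where u∈D = ∈─⁺ (T⊆N (M⊆T u∈M)) u∉Q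
        ... | yes (z , z∈) | no D⊈M = x∈∁p⇒x∉p (p∩q⊆q M (∁ D) (minM (tight∩ , M⊆T ∘ p∩q⊆p M (∁ D)) (p∩q⊆p M (∁ D)) u∈M)) u∈D
          where
          D = N ─ Q
          u∈D = ∈─⁺ (T⊆N (M⊆T u∈M)) u∉Q
          y = proj₁ (⊈⇒∃ D⊈M)
          y∈D = proj₁ (∈─⁻ {X = D} (proj₂ (⊈⇒∃ D⊈M)))
          y∉M = proj₂ (∈─⁻ {X = D} (proj₂ (⊈⇒∃ D⊈M)))
          lo∪ : k ≤ F (M ∪ ∁ D)
          lo∪ = lo (u , x∈p∪q⁺ (inj₁ u∈M))
            (y , x∉p⇒x∈∁p λ y∈ → [ y∉M , x∈p⇒x∉∁p y∈D ]′ (x∈p∪q⁻ M (∁ D) y∈))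
          tight∩ : Tight (M ∩ ∁ D)
          tight∩ = (subst Nonempty (─-as-∩ M D) (z , z∈)
                   , y , x∉p⇒x∈∁p (y∉M ∘ p∩q⊆p M (∁ D)))
            , ℤ.≤-trans (cancelʳ-≤ (FF M (∁ D)) (ℤ.≤-trans (low-─ tQ esc) lo∪)) (proj₂ tM)

    minimalRegion : Region N
    minimalRegion = record
      { F∁N≤k = low
      ; minimal = λ A⊆N _ lowA tight⊆A → minN (lowA , M₀ , tM₀ , tight⊆A tM₀ M₀⊆N) A⊆N
      ; seedIn = seedIn
      ; aSeed = let (u , _ , sd) = seedIn tM₀ M₀⊆N in u , sd }

  transferWalk : ∃[ u ] 0ℤ < d u → Result
  transferWalk pos with anySubset? tight?
  ... | no none = regionResult (trivialRegion none pos)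
  ... | yes (M , tM)
    -- The full vertex set is a candidate because `F∅≤k` bounds its out-degree.
    with minimalSubset (λ Y → (F (∁ Y) ℤ.≤? k) ×-dec anySubset? λ M → tight? M ×-dec (M ⊆? Y)) (⊤ , F∅≤k , M , tM , ⊆⊤)
  ... | N , (low , M₀ , tM₀ , M₀⊆N) , minN = regionResult (minimalRegion low M₀ tM₀ M₀⊆N (λ {Y} → minN {Y}))

-- Reconfiguration of head choices

∣pred∣< : ∀ {x} → 0ℤ < x → ∣ x + - 1ℤ ∣ ℕ.< ∣ x ∣
∣pred∣< {ℤ.+ suc m} _ = ℕ.≤-refl
∣pred∣< {ℤ.+ zero} (+<+ ())

∣suc∣< : ∀ {x} → x < 0ℤ → ∣ x + 1ℤ ∣ ℕ.< ∣ x ∣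
∣suc∣< {ℤ.-[1+ zero ]} _ = ℕ.≤-refl
∣suc∣< {ℤ.-[1+ suc m ]} _ = ℕ.≤-refl
∣suc∣< {ℤ.+ m} (+<+ ())

<suc⇒≤ : ∀ {i} m → i < ℤ.+ suc m → i ≤ ℤ.+ m
<suc⇒≤ m p = ℤ.i<j⇒i≤pred[j] p

telescope : ∀ x a b c → x + (b + - a) + (c + - b) ≡ x + (c + - a)
telescope = solve-∀

telescope′ : ∀ x a b c → x + (a + - b) + (b + - c) ≡ x + (a + - c)
telescope′ = solve-∀

add-zero : ∀ x a → x ≡ x + (a + - a)
add-zero = solve-∀

swap-out : ∀ a b c → a + - b + (c + - a) ≡ c + - b
swap-out = solve-∀

minus-+ : ∀ a b c → a + - (b + c) ≡ a + - b + - c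
minus-+ = solve-∀

+-minus-comm : ∀ a b c → a + b + - c ≡ a + - c + b
+-minus-comm = solve-∀

self-cancel : ∀ a → a + 0ℤ + - a ≡ 0ℤ
self-cancel = solve-∀

module Reconfiguration {n e : ℕ} (Z : Fin e → Subset n) (k : ℤ) (0≤k : 0ℤ ≤ k) where

  open Orientation Z

  Connected : Heads → Set
  Connected h = ∀ {X} → Nonempty X → Nonempty (∁ X) → k ≤ F h X

  record Good (h : Heads) : Set where
    constructor good
    field
      isValid   : Valid h
      connected : Connected h

  open Good

  -- Both ends are good and the head really changes, so that a flip can be reversed and `new` lies
  -- in the tail of the hyperarc.
  record Flip (h h′ : Heads) : Set where
    field
      good₁ : Good h
      good₂ : Good h′
      edge  : Fin e
      new   : Fin n
      new∈  : new ∈ Z edge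
      new≢  : lookup h edge ≢ new
      h′≡   : h′ ≡ h [ edge ]≔ new

  Flip-sym : ∀ {h h′} → Flip h h′ → Flip h′ h
  Flip-sym {h} {h′} f = record
    { good₁ = good₂ ; good₂ = good₁ ; edge = edge ; new = lookup h edge ; new∈ = Valid.head∈ (isValid good₁) edge
    ; new≢ = λ eq → new≢ (trans (sym eq) new-lookup)
    ; h′≡ = sym (trans (cong (λ g → g [ edge ]≔ lookup h edge) h′≡)
                (trans (Vec.[]≔-idempotent h edge) (Vec.[]≔-lookup h edge))) }
    where
    open Flip f
    new-lookup : lookup h′ edge ≡ new
    new-lookup = trans (cong (λ g → lookup g edge) h′≡) (Vec.lookup∘update edge h new)

  F-∁⊤ : ∀ {h} → Valid h → F h (∁ ⊤) ≤ k
  F-∁⊤ {h} val = subst (_≤ k) (sym (trans (F-count val (∁ ⊤)) (sum-zero λ i → ind-no (enters? h (∁ ⊤) i) λ (p , _) → x∈∁p⇒x∉p p ∈⊤))) 0≤k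

  F-transfer : ∀ {h h′ v u} → (∀ w → headCount h′ w ≡ headCount h w + transfer v u w) →
    ∀ X → F h′ X ≡ F h X + (ι u X + - ι v X)
  F-transfer {h} {h′} {v} {u} p X = trans (F-shift {h} {h′} (transfer v u) p X) (cong (F h X +_) (wt-transfer v u X))

  transfer-trans : ∀ (a b c w : Fin n) x → x + transfer a b w + transfer b c w ≡ x + transfer a c w
  transfer-trans a b c w x = telescope x (χ a w) (χ b w) (χ c w)

  transfer-trans′ : ∀ (a b c w : Fin n) x → x + transfer b a w + transfer c b w ≡ x + transfer c a w
  transfer-trans′ a b c w x = telescope′ x (χ a w) (χ b w) (χ c w)

  transfer-self : ∀ (a w : Fin n) x → x ≡ x + transfer a a w
  transfer-self a w x = add-zero x (χ a w)

  module _ (t : Fin n → ℤ) (t-hi : ∀ {X} → Nonempty X → Nonempty (∁ X) → k < wt t X + - inner X) where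

    deficit : Heads → Fin n → ℤ
    deficit h w = t w + - headCount h w

    module Round {h} (gd : Good h) (total : wt (deficit h) ⊤ ≡ 0ℤ) where

      hi : ∀ {X} → Nonempty X → Nonempty (∁ X) → k < F h X + wt (deficit h) X
      hi {X} ne ne′ = subst (k <_) (sym eq) (t-hi ne ne′)
        where
        eq : F h X + wt (deficit h) X ≡ wt t X + - inner X
        eq = trans (cong (F h X +_) (trans (wt-+ t (λ w → - headCount h w) X) (cong (wt t X +_) (wt-neg (headCount h) X))))
                   (swap-out (wt (headCount h) X) (inner X) (wt t X))

      open Step (F h) (F-submodular h) (Arc h) (arc? h) (F-noArcInto (isValid gd)) (F-noArcOut (isValid gd))
        k (F-∁⊤ (isValid gd)) (connected gd) (deficit h) total hi public

      end∈ : ∀ {u vs w} → Walk u vs w → w ∈ˡ vs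
      end∈ start = here refl
      end∈ (step _ _ _ _) = here refl

      record FlippedTo (u w : Fin n) (vs : List (Fin n)) : Set where
        field
          h′        : Heads
          flips     : Star Flip h h′
          isGood    : Good h′
          counts    : ∀ x → headCount h′ x ≡ headCount h x + transfer w u x
          unchanged : ∀ i → ¬ (lookup h i ∈ˡ vs) → lookup h′ i ≡ lookup h i

      -- The arcs of the walk have distinct heads, so those not yet flipped are still present.
      flipWalk : ∀ {u vs w} → Walk u vs w → FlippedTo u w vs
      flipWalk {u} start = record
        { h′ = h ; flips = ε ; isGood = gd ; counts = λ x → transfer-self u x (headCount h x) ; unchanged = λ _ _ → refl }
      flipWalk {u} (step {vs} {x} {y} wk (i , hi≡y , x∈Z) y∉vs free) = record
        { h′ = g ; flips = IH.flips ◅◅ (flip ◅ ε) ; isGood = gd′ ; counts = counts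
        ; unchanged = λ j hj∉ → trans (Vec.lookup∘update′ (λ { refl → hj∉ (here hi≡y) }) IH.h′ x)
                                      (IH.unchanged j (hj∉ ∘ there)) }
        where
        module IH = FlippedTo (flipWalk wk)
        g = IH.h′ [ i ]≔ x
        old : lookup IH.h′ i ≡ y
        old = trans (IH.unchanged i (λ hi∈ → y∉vs (subst (_∈ˡ vs) hi≡y hi∈))) hi≡y
        counts : ∀ z → headCount g z ≡ headCount h z + transfer y u z
        counts z = trans (headCount-update IH.h′ i x z)
          (trans (cong₂ (λ a b → a + transfer b x z) (IH.counts z) old) (transfer-trans′ u x y z (headCount h z)))
        gd′ : Good g
        -- Connectivity is compared with the initial h, from which g differs only by the transfer
        -- from y to u.
        gd′ = good (Valid-update (isValid IH.isGood) x∈Z) λ {X} ne ne′ →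
          subst (k ≤_) (sym (F-transfer {h} {g} counts X)) (transfer-≥ y u X (connected gd ne ne′) λ y∈ u∉ →
            ℤ.≰⇒> λ p → free (X , ((ne , ne′) , p) , y∈ , u∉))
        flip : Flip IH.h′ g
        flip = record { good₁ = IH.isGood ; good₂ = gd′ ; edge = i ; new = x ; new∈ = x∈Z
                      ; new≢ = λ eq → y∉vs (subst (_∈ˡ vs) (trans (sym eq) old) (end∈ wk)) ; h′≡ = refl }

    potential : Heads → ℤ
    potential h = sum λ w → ℤ.+ ∣ deficit h w ∣

    -- A vector of total 0 without positive entries is zero.
    settled : ∀ {h} → wt (deficit h) ⊤ ≡ 0ℤ → ¬ (∃[ u ] 0ℤ < deficit h u) → ∀ w → headCount h w ≡ t w
    settled {h} total none w = sym (ℤ.i-j≡0⇒i≡j (t w) (headCount h w) (ℤ.≤∧≮⇒≡ (≤0 w) λ dw<0 → ℤ.<-irrefl total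
      (subst (wt (deficit h) ⊤ <_) (sum-zero {n} {f = λ _ → 0ℤ} λ _ → refl)
        (sum-mono-< (λ v → subst (_≤ 0ℤ) (sym (pick-⊤ v)) (≤0 v)) w (subst (_< 0ℤ) (sym (pick-⊤ w)) dw<0)))))
      where
      ≤0 : ∀ w → deficit h w ≤ 0ℤ
      ≤0 w = ℤ.≮⇒≥ λ 0<d → none (w , 0<d)
      pick-⊤ : ∀ w → pick (lookup (⊤ {n}) w) (deficit h w) ≡ deficit h w
      pick-⊤ w = cong (λ b → pick b (deficit h w)) (∈⇒true {v = w} {⊤} ∈⊤)

    module _ {h h′ : Heads} {u v : Fin n} (counts : ∀ w → headCount h′ w ≡ headCount h w + transfer v u w) where

      private
        deficit′ : ∀ w → deficit h′ w ≡ deficit h w + - transfer v u w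
        deficit′ w = trans (cong (λ c → t w + - c) (counts w)) (minus-+ (t w) (headCount h w) (transfer v u w))

      total-transfer : wt (deficit h) ⊤ ≡ 0ℤ → wt (deficit h′) ⊤ ≡ 0ℤ
      total-transfer total = trans (wt-cong deficit′ ⊤) (trans (wt-+ (deficit h) (λ w → - transfer v u w) ⊤)
        (cong₂ _+_ total (trans (wt-neg (transfer v u) ⊤) (cong -_ (wt-transfer-⊤ v u)))))

      potential-decreases : 0ℤ < deficit h u → deficit h v < 0ℤ → potential h′ < potential h
      potential-decreases 0<du dv<0 = sum-mono-< (λ w → +≤+ (shrink w)) u (+<+ shrinkU)
        where
        u≢v : u ≢ v
        u≢v u≡v = ℤ.<-asym 0<du (subst (λ w → deficit h w < 0ℤ) (sym u≡v) dv<0)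
        atU : deficit h′ u ≡ deficit h u + - 1ℤ
        atU = trans (deficit′ u) (cong₂ (λ a b → deficit h u + - (a + - b)) (χ-refl u) (χ-≢ (u≢v ∘ sym)))
        atV : deficit h′ v ≡ deficit h v + 1ℤ
        atV = trans (deficit′ v) (cong₂ (λ a b → deficit h v + - (a + - b)) (χ-≢ u≢v) (χ-refl v))
        elsewhere : ∀ {w} → u ≢ w → v ≢ w → deficit h′ w ≡ deficit h w
        elsewhere {w} u≢w v≢w = trans (deficit′ w)
          (trans (cong₂ (λ a b → deficit h w + - (a + - b)) (χ-≢ u≢w) (χ-≢ v≢w)) (ℤ.+-identityʳ (deficit h w)))
        shrinkU : ∣ deficit h′ u ∣ ℕ.< ∣ deficit h u ∣
        shrinkU = subst (λ x → ∣ x ∣ ℕ.< ∣ deficit h u ∣) (sym atU) (∣pred∣< 0<du)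
        shrinkV : ∣ deficit h′ v ∣ ℕ.< ∣ deficit h v ∣
        shrinkV = subst (λ x → ∣ x ∣ ℕ.< ∣ deficit h v ∣) (sym atV) (∣suc∣< dv<0)
        shrink : ∀ w → ∣ deficit h′ w ∣ ℕ.≤ ∣ deficit h w ∣
        shrink w = case u Fin.≟ w of λ where
          (yes u≡w) → subst (λ w → ∣ deficit h′ w ∣ ℕ.≤ ∣ deficit h w ∣) u≡w (ℕ.<⇒≤ shrinkU)
          (no u≢w) → case v Fin.≟ w of λ where
            (yes v≡w) → subst (λ w → ∣ deficit h′ w ∣ ℕ.≤ ∣ deficit h w ∣) v≡w (ℕ.<⇒≤ shrinkV)
            (no v≢w) → ℕ.≤-reflexive (cong ∣_∣ (elsewhere u≢w v≢w))

    potential-≥0 : ∀ h → 0ℤ ≤ potential h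
    potential-≥0 h = subst (_≤ potential h) (sum-zero {n} {f = λ _ → 0ℤ} λ _ → refl)
      (sum-mono-≤ {n} {λ _ → 0ℤ} λ w → +≤+ ℕ.z≤n)

    Closer : Heads → Set
    Closer h = ∃[ h′ ] Star Flip h h′ × Good h′ × wt (deficit h′) ⊤ ≡ 0ℤ × potential h′ < potential h

    closer : ∀ {h} → Good h → wt (deficit h) ⊤ ≡ 0ℤ → ∃[ u ] 0ℤ < deficit h u → Closer h
    closer {h} gd total pos = go (Round.transferWalk gd total pos)
      where
      go : Round.Result gd total → Closer h
      go (u , v , vs , wk , 0<du , dv<0) =
        h′ , flips , isGood , total-transfer {h} {h′} {u} {v} counts total , potential-decreases {h} {h′} {u} {v} counts 0<du dv<0
        where open Round.FlippedTo (Round.flipWalk gd total wk)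

    approach : ∀ s h → Good h → wt (deficit h) ⊤ ≡ 0ℤ → potential h ≤ ℤ.+ s →
      ∃[ h′ ] Star Flip h h′ × Good h′ × (∀ w → headCount h′ w ≡ t w)
    approach s h gd total bound with Fin.any? (λ u → 0ℤ ℤ.<? deficit h u)
    ... | no none = h , ε , gd , settled {h} total none
    ... | yes pos = continue s bound (closer gd total pos)
      where
      continue : ∀ s → potential h ≤ ℤ.+ s → Closer h → ∃[ h″ ] Star Flip h h″ × Good h″ × (∀ w → headCount h″ w ≡ t w)
      continue zero bound (h′ , _ , _ , _ , decrease) = ≤<-absurd (potential-≥0 h′) (ℤ.<-≤-trans decrease bound)
      continue (suc s) bound (h′ , flips , gd′ , total′ , decrease) =
        let (h″ , flips′ , rest) = approach s h′ gd′ total′ (<suc⇒≤ s (ℤ.<-≤-trans decrease bound))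
        in h″ , flips ◅◅ flips′ , rest

  -- Aligning two orientations with equal head counts

  module _ (h₂ : Heads) (val₂ : Valid h₂) (hi₂ : ∀ {X} → Nonempty X → Nonempty (∁ X) → k < F h₂ X) where

    differs? : ∀ h i → Dec (lookup h i ≢ lookup h₂ i)
    differs? h i = ¬? (lookup h i Fin.≟ lookup h₂ i)

    differences : Heads → ℤ
    differences h = sum λ i → ind (differs? h i)

    -- The invariant while a closed walk is traced: relative to `h₂` one unit sits at u instead of
    -- v, and for u = v the walk has closed.
    Offset : Heads → Fin n → Fin n → Set
    Offset h v u = ∀ w → headCount h w ≡ headCount h₂ w + transfer v u w

    -- If u = v, a new walk may start at the head of any differing hyperedge. If not, u is the head
    -- of more hyperedges in h than in `h₂`, so some hyperedge has head u only in h.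
    surplus-edge : ∀ h v u → Offset h v u → ∀ i → lookup h i ≢ lookup h₂ i →
      ∃[ v′ ] ∃[ i′ ] lookup h i′ ≢ lookup h₂ i′ × Offset h v′ (lookup h i′)
    surplus-edge h v u off i differs with u Fin.≟ v
    ... | yes refl = lookup h i , i , differs , λ w →
      trans (off w) (trans (sym (transfer-self u w (headCount h₂ w))) (transfer-self (lookup h i) w (headCount h₂ w)))
    ... | no u≢v with Fin.any? (λ j → (lookup h j Fin.≟ u) ×-dec ¬? (lookup h₂ j Fin.≟ u))
    ... | yes (j , refl , h₂j≢u) = v , j , (λ eq → h₂j≢u (sym eq)) , off
    ... | no none = ≤<-absurd (sum-mono-≤ each)
      (subst (headCount h₂ u <_)
        (sym (trans (off u) (trans (cong₂ (λ a b → headCount h₂ u + (a + - b)) (χ-refl u) (χ-≢ (u≢v ∘ sym)))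
                                   (ℤ.+-comm (headCount h₂ u) 1ℤ))))
        (<suc (headCount h₂ u)))
      where
      each : ∀ j → χ (lookup h j) u ≤ χ (lookup h₂ j) u
      each j with lookup h j Fin.≟ u | lookup h₂ j Fin.≟ u
      ... | yes p | no q = contradiction (j , p , q) none
      ... | yes _ | yes _ = ℤ.≤-refl
      ... | no _ | yes _ = +≤+ ℕ.z≤n
      ... | no _ | no _ = ℤ.≤-refl

    -- Giving hyperedge i its head from `h₂` moves the surplus there and removes a difference. Each
    -- new head vector is one transfer away from `h₂`, so k remains of the bound k + 1.
    align : ∀ s h v u → Good h → Offset h v u → differences h ≤ ℤ.+ s → Star Flip h h₂
    align s h v₀ u₀ gd off bound with Fin.any? (differs? h)
    ... | no none = subst (Star Flip h) h≡h₂ ε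
      where
      h≡h₂ : h ≡ h₂
      h≡h₂ = trans (sym (Vec.tabulate∘lookup h)) (trans
        (Vec.tabulate-cong λ i → decidable-stable (lookup h i Fin.≟ lookup h₂ i) λ differs → none (i , differs))
        (Vec.tabulate∘lookup h₂))
    ... | yes (i₀ , differs₀) with surplus-edge h v₀ u₀ off i₀ differs₀
    ... | v , i , differs , off′ = continue s bound
      where
      x = lookup h₂ i
      g = h [ i ]≔ x
      off″ : Offset g v x
      off″ w = trans (headCount-update h i x w)
        (trans (cong (_+ transfer (lookup h i) x w) (off′ w)) (transfer-trans v (lookup h i) x w (headCount h₂ w)))
      gd′ : Good g
      gd′ = good (Valid-update (isValid gd) (Valid.head∈ val₂ i)) λ {X} ne ne′ →
        subst (k ≤_) (sym (F-transfer {h₂} {g} off″ X)) (transfer-≥ v x X (ℤ.<⇒≤ (hi₂ ne ne′)) λ _ _ → hi₂ ne ne′)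
      flip : Flip h g
      flip = record { good₁ = gd ; good₂ = gd′ ; edge = i ; new = x ; new∈ = Valid.head∈ val₂ i ; new≢ = differs ; h′≡ = refl }
      decrease : differences g < differences h
      decrease = sum-mono-< fewer i (subst₂ _<_ (sym at-g) (sym (ind-yes (differs? h i) differs)) (+<+ ℕ.≤-refl))
        where
        at-g : ind (differs? g i) ≡ 0ℤ
        at-g = ind-no (differs? g i) λ p → p (Vec.lookup∘update i h x)
        fewer : ∀ j → ind (differs? g j) ≤ ind (differs? h j)
        fewer j = ind-mono (differs? g j) (differs? h j) λ p q → case j Fin.≟ i of λ where
          (yes refl) → p (Vec.lookup∘update i h x)
          (no j≢i) → p (trans (Vec.lookup∘update′ j≢i h x) q)
      continue : ∀ s → differences h ≤ ℤ.+ s → Star Flip h h₂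
      continue zero bound = ≤<-absurd
        (subst (_≤ differences g) (sum-zero {e} {f = λ _ → 0ℤ} λ _ → refl)
          (sum-mono-≤ {e} {λ _ → 0ℤ} λ j → ind-≥0 (differs? g j)))
        (ℤ.<-≤-trans decrease bound)
      continue (suc s) bound = flip ◅ align s g v x gd′ off″ (<suc⇒≤ s (ℤ.<-≤-trans decrease bound))

  ≤∣∣ : ∀ x → x ≤ ℤ.+ ∣ x ∣
  ≤∣∣ (ℤ.+ m) = ℤ.≤-refl
  ≤∣∣ ℤ.-[1+ m ] = ℤ.-≤+

  reconfigure : (∀ P → IsPartition P → 2 ℕ.≤ length P → sumL (λ _ → ℤ.suc k) P ≤ crossing P) →
    Fin n → ∀ {h₁ h₂} → Good h₁ → Good h₂ → Star Flip h₁ h₂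
  reconfigure conn r {h₁} {h₂} gd₁ gd₂
    with balance r k (F-laws (ℤ.suc k) conn r (isValid gd₁))
           (λ ne r∉ → connected gd₁ ne (r , x∉p⇒x∈∁p r∉))
           (λ {X} ne r∉ → connected gd₁ (r , x∉p⇒x∈∁p r∉) (subst Nonempty (sym (∁-involutive X)) ne))
  ... | F′ , G′ , sh , F-hi , G-hi = meet
    where
    open Shifted sh
    t : Fin n → ℤ
    t w = headCount h₁ w + d w
    t-F : ∀ X → wt t X + - inner X ≡ F h₁ X + wt d X
    t-F X = trans (cong (_+ - inner X) (wt-+ (headCount h₁) d X)) (+-minus-comm (wt (headCount h₁) X) (wt d X) (inner X))
    t-hi : ∀ {X} → Nonempty X → Nonempty (∁ X) → k < wt t X + - inner X
    -- `balance` speaks of sets avoiding r; a set containing r is reached through `G′` at its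
    -- complement.
    t-hi {X} ne ne′ with r ∈? X
    ... | no r∉X = subst (k <_) (trans (eqF X) (sym (t-F X))) (F-hi ne r∉X)
    ... | yes r∈X = subst (k <_) eq (G-hi ne′ (x∈p⇒x∉∁p r∈X))
      where
      eq : G′ (∁ X) ≡ wt t X + - inner X
      eq = trans (eqG (∁ X)) (trans
        (cong₂ (λ Y s → F h₁ Y + s) (∁-involutive X) (trans (cong -_ (wt-∁ d total X)) (ℤ.neg-involutive (wt d X))))
        (sym (t-F X)))
    headCount-⊤ : ∀ h → wt (headCount h) ⊤ ≡ sum {e} (λ _ → 1ℤ)
    headCount-⊤ h = trans (wt-headCount h ⊤) (sum-cong-≗ λ i → ι-∈ {v = lookup h i} {⊤} ∈⊤)
    total′ : ∀ h → wt (deficit t t-hi h) ⊤ ≡ 0ℤ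
    total′ h = trans (wt-+ t (λ w → - headCount h w) ⊤) (trans
      (cong₂ _+_ (trans (wt-+ (headCount h₁) d ⊤) (cong₂ _+_ (headCount-⊤ h₁) total))
                 (trans (wt-neg (headCount h) ⊤) (cong -_ (headCount-⊤ h))))
      (self-cancel (sum {e} (λ _ → 1ℤ))))
    reach : ∀ h → Good h → ∃[ h′ ] Star Flip h h′ × Good h′ × (∀ w → headCount h′ w ≡ t w)
    reach h gd = approach t t-hi _ h gd (total′ h) (≤∣∣ (potential t t-hi h))
    meet : Star Flip h₁ h₂
    meet =
      let (g₁ , p₁ , gg₁ , c₁) = reach h₁ gd₁
          (g₂ , p₂ , gg₂ , c₂) = reach h₂ gd₂
          hi₂ : ∀ {X} → Nonempty X → Nonempty (∁ X) → k < F g₂ X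
          hi₂ {X} ne ne′ = subst (k <_) (sym (cong (_+ - inner X) (wt-cong c₂ X))) (t-hi ne ne′)
          off = λ w → trans (c₁ w) (trans (sym (c₂ w)) (transfer-self r w (headCount g₂ w)))
      -- Both orientations are brought to the head counts t; the second path is traversed backwards.
      in p₁ ◅◅ align g₂ (isValid gg₂) hi₂ _ g₁ r r gg₁ off (≤∣∣ _) ◅◅ reverse Flip-sym p₂

-- Translation between head choices and lists of hyperarcs

length-filter-tabulate : ∀ {A : Set} {P : A → Set} (P? : Decidable P) {e} (f : Fin e → A) →
  ℤ.+ length (filter P? (tabulate f)) ≡ sum (λ i → ind (P? (f i)))
length-filter-tabulate P? {zero} f = refl
length-filter-tabulate P? {suc e} f with P? (f zero)
... | yes _ = cong (1ℤ +_) (length-filter-tabulate P? (f ∘ suc))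
... | no _ = trans (length-filter-tabulate P? (f ∘ suc)) (sym (ℤ.+-identityˡ _))

tabulate-↭ : ∀ {A : Set} {e} (f g : Fin e → A) i → (∀ j → j ≢ i → g j ≡ f j) →
  ∃[ C ] (tabulate f ↭ f i ∷ C × tabulate g ↭ g i ∷ C)
tabulate-↭ f g zero same = tabulate (f ∘ suc) , ↭-refl ,
  ↭-reflexive (cong (g zero ∷_) (tabulate-cong λ j → same (suc j) λ ()))
tabulate-↭ f g (suc i) same =
  let (C , p , q) = tabulate-↭ (f ∘ suc) (g ∘ suc) i (λ j j≢i → same (suc j) (j≢i ∘ Fin.suc-injective))
  in f zero ∷ C , ↭-trans (prep (f zero) p) (swap (f zero) (f (suc i)) ↭-refl) ,
     ↭-trans (prep (g zero) q) (subst (λ x → g zero ∷ g (suc i) ∷ C ↭ g (suc i) ∷ x ∷ C) (same zero λ ())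
                                  (swap (g zero) (g (suc i)) ↭-refl))

pointwise-tabulate : ∀ {A B : Set} {R : A → B → Set} xs (f : Fin (length xs) → B) →
  (∀ i → R (List.lookup xs i) (f i)) → Pointwise R xs (tabulate f)
pointwise-tabulate [] f r = []
pointwise-tabulate (x ∷ xs) f r = r zero ∷ pointwise-tabulate xs (f ∘ suc) (r ∘ suc)

reorient-orientTowards : ∀ {Z : Subset n} {v u} → v ∈ Z → v ≢ u → reorient (orientTowards Z v) u ≡ orientTowards Z u
reorient-orientTowards {Z = Z} {v} {u} v∈Z v≢u = cong (λ Y → hyperarc Y u) (⊆-antisym to from)
  where
  to : (Z - v - u) ∪ ⁅ v ⁆ ⊆ Z - u
  to w∈ with x∈p∪q⁻ (Z - v - u) ⁅ v ⁆ w∈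
  ... | inj₁ p = let (a , b) = ∈─⁻ {X = Z - v} p in ∈─⁺ (proj₁ (∈─⁻ {X = Z} a)) b
  ... | inj₂ p = subst (_∈ Z - u) (sym (x∈⁅y⁆⇒x≡y v p)) (x∈p∧x≢y⇒x∈p-y v∈Z v≢u)
  from : Z - u ⊆ (Z - v - u) ∪ ⁅ v ⁆
  from {w} w∈ with w ∈? ⁅ v ⁆
  ... | yes p = x∈p∪q⁺ (inj₂ p)
  ... | no p = let (a , b) = ∈─⁻ {X = Z} w∈ in x∈p∪q⁺ (inj₁ (∈─⁺ (∈─⁺ a p) b))

empty-unique : ∀ {e} (h h′ : Vec (Fin 0) e) → h ≡ h′
empty-unique [] [] = refl
empty-unique (() ∷ _)

module Translation (k n : ℕ) (H : Hypergraph n) where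

  Z : Fin (length (edges H)) → Subset n
  Z = List.lookup (edges H)

  open Orientation Z
  open Reconfiguration Z (ℤ.+ k) (+≤+ ℕ.z≤n)

  arcs : Heads → List (Hyperarc n)
  arcs h = tabulate λ i → orientTowards (Z i) (lookup h i)

  heads-of : ∀ {xs B} → Pointwise _OrientsTo_ xs B →
    Σ[ h ∈ Vec (Fin n) (length xs) ] (∀ i → lookup h i ∈ List.lookup xs i) ×
      B ≡ tabulate (λ i → orientTowards (List.lookup xs i) (lookup h i))
  heads-of [] = [] , (λ ()) , refl
  heads-of ((v , v∈ , refl) ∷ ps) =
    let (h , val , eq) = heads-of ps
    in v ∷ h , (λ { zero → v∈ ; (suc i) → val i }) , cong (_ ∷_) eq

  -- The tail omits the head, but the head is outside X, so the tail meets X exactly when the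
  -- hyperedge does.
  outDegree-F : ∀ {h} → Valid h → ∀ X → ℤ.+ outDegree (arcs h) X ≡ F h (∁ X)
  outDegree-F {h} val X = trans
    (length-filter-tabulate (λ a → ¬? (head a ∈? X) ×-dec nonempty? (tail a ∩ X)) (λ i → orientTowards (Z i) (lookup h i)))
    (trans (sum-cong-≗ λ i → ind-cong (¬? (lookup h i ∈? X) ×-dec nonempty? ((Z i - lookup h i) ∩ X)) (enters? h (∁ X) i) (to i) (from i))
           (sym (F-count val (∁ X))))
    where
    to : ∀ i → lookup h i ∉ X × Nonempty ((Z i - lookup h i) ∩ X) → lookup h i ∈ ∁ X × ¬ Z i ⊆ ∁ X
    to i (v∉X , z , z∈) =
      let (a , b) = x∈p∩q⁻ (Z i - lookup h i) X z∈
      in x∉p⇒x∈∁p v∉X , λ Z⊆ → x∈∁p⇒x∉p (Z⊆ (proj₁ (∈─⁻ {X = Z i} a))) b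
    from : ∀ i → lookup h i ∈ ∁ X × ¬ Z i ⊆ ∁ X → lookup h i ∉ X × Nonempty ((Z i - lookup h i) ∩ X)
    from i (v∈∁X , Z⊈) =
      let (z , z∈) = ⊈⇒∃ Z⊈
          (z∈Z , z∉) = ∈─⁻ {X = Z i} z∈
          z∈X = x∉∁p⇒x∈p z∉
          v∉X = x∈∁p⇒x∉p v∈∁X
      in v∉X , z , x∈p∩q⁺ (x∈p∧x≢y⇒x∈p-y z∈Z (λ z≡v → v∉X (subst (_∈ X) z≡v z∈X)) , z∈X)

  good⇒connected : ∀ {h} → Good h → HyperarcConnected k (arcs h)
  good⇒connected {h} gd X ne (_ , w , _ , w∉X) = ℤ.drop‿+≤+ (subst (ℤ.+ k ≤_) (sym (outDegree-F (Good.isValid gd) X))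
    (Good.connected gd (w , x∉p⇒x∈∁p w∉X) (subst Nonempty (sym (∁-involutive X)) ne)))

  good⇒orientation : ∀ {h} → Good h → IsConnectedOrientation k H (arcs h)
  good⇒orientation {h} gd =
    (arcs h , pointwise-tabulate (edges H) _ (λ i → lookup h i , Valid.head∈ (Good.isValid gd) i , refl) , ↭-refl) ,
    good⇒connected gd

  orientation⇒good : ∀ {A} → IsConnectedOrientation k H A → ∃[ h ] Good h × arcs h ↭ A
  orientation⇒good {A} ((B , ps , B↭A) , conn) with heads-of ps
  ... | h , val , refl = h , good (valid val) conn′ , B↭A
    where
    conn′ : Connected h
    conn′ {X} (x , x∈X) ne = subst (ℤ.+ k ≤_)
      (trans (outDegree-F {h} (valid val) (∁ X)) (cong (F h) (∁-involutive X)))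
      (+≤+ (subst (k ℕ.≤_)
        (sym (↭-length (filter-↭ (λ a → ¬? (head a ∈? ∁ X) ×-dec nonempty? (tail a ∩ ∁ X)) B↭A)))
        (conn (∁ X) ne (⊆⊤ , x , ∈⊤ , x∈p⇒x∉∁p x∈X))))

  flip⇒reorients : ∀ {h h′} → Flip h h′ → ReorientsOneTo (arcs h) (arcs h′)
  flip⇒reorients {h} {h′} fl =
    let (C , p , q) = tabulate-↭ (λ j → orientTowards (Z j) (lookup h j)) (λ j → orientTowards (Z j) (lookup h′ j)) edge
                        (λ j j≢ → cong (orientTowards (Z j)) (trans (cong (λ g → lookup g j) h′≡) (Vec.lookup∘update′ j≢ h new)))
    in orientTowards (Z edge) (lookup h edge) , new , C
     , x∈p∧x≢y⇒x∈p-y new∈ (new≢ ∘ sym) , p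
     , subst (λ a → arcs h′ ↭ a ∷ C)
         (trans (cong (orientTowards (Z edge)) (trans (cong (λ g → lookup g edge) h′≡) (Vec.lookup∘update edge h new)))
                (sym (reorient-orientTowards (Valid.head∈ (Good.isValid good₁) edge) new≢))) q
    where open Flip fl

  crossing-≥ : PartitionConnected (suc k) H → ∀ P → IsPartition P → 2 ℕ.≤ length P →
    sumL (λ _ → ℤ.+ suc k) P ≤ crossing P
  crossing-≥ pc P isP two = subst₂ _≤_ (sym (const-sumL P)) count (+≤+ (pc P isP two))
    where
    const-sumL : ∀ P → sumL {n} (λ _ → ℤ.+ suc k) P ≡ ℤ.+ (suc k ℕ.* length P)
    const-sumL [] = cong ℤ.+_ (sym (ℕ.*-zeroʳ (suc k)))
    const-sumL (_ ∷ P) = trans (cong (ℤ.+ suc k +_) (const-sumL P)) (cong ℤ.+_ (sym (ℕ.*-suc (suc k) (length P))))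
    crosses? : Decidable (λ W → 2 ℕ.≤ partsMet P W)
    crosses? W = 2 ℕ.≤? partsMet P W
    count : ℤ.+ crossingEdges H P ≡ crossing P
    count = trans (cong (λ xs → ℤ.+ length (filter crosses? xs)) (sym (tabulate-lookup (edges H))))
                  (length-filter-tabulate crosses? Z)

  Sequence : (A A′ : List (Hyperarc n)) → Set
  Sequence A A′ = Σ[ ℓ ∈ ℕ ] Σ[ T ∈ (Fin (suc ℓ) → List (Hyperarc n)) ]
    ( T zero ↭ A
    × T (fromℕ ℓ) ↭ A′
    × ((i : Fin (suc ℓ)) → IsConnectedOrientation k H (T i))
    × ((i : Fin ℓ) → ReorientsOneTo (T (inject₁ i)) (T (suc i))) )

  -- The first term is required to be arcs h on the nose, so that a further step can be prepended.
  sequence : ∀ {h h′ A′} → Good h → Star Flip h h′ → arcs h′ ↭ A′ →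
    Σ[ s ∈ Sequence (arcs h) A′ ] (proj₁ (proj₂ s) zero ≡ arcs h)
  sequence {h} gd ε p = (0 , (λ _ → arcs h) , ↭-refl , p , (λ _ → good⇒orientation gd) , λ ()) , refl
  sequence {h} gd (fl ◅ fls) p with sequence (Flip.good₂ fl) fls p
  ... | (ℓ , T , _ , last , ori , steps) , T0 =
    (suc ℓ , T′ , ↭-refl , last , (λ { zero → good⇒orientation gd ; (suc i) → ori i }) , steps′) , refl
    where
    T′ : Fin (suc (suc ℓ)) → List (Hyperarc n)
    T′ zero = arcs h
    T′ (suc i) = T i
    steps′ : ∀ i → ReorientsOneTo (T′ (inject₁ i)) (T′ (suc i))
    steps′ zero = subst (ReorientsOneTo (arcs h)) (sym T0) (flip⇒reorients fl)
    steps′ (suc i) = steps i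

  connect : ∀ {h h′} → Star Flip h h′ → ∀ {A A′} → Good h → arcs h ↭ A → arcs h′ ↭ A′ → Sequence A A′
  connect fls gd p q =
    let ((ℓ , T , first , rest) , _) = sequence gd fls q in ℓ , T , ↭-trans first p , rest

mainTheorem4 : (k n : ℕ) (H : Hypergraph n) → PartitionConnected (suc k) H →
    (A A′ : List (Hyperarc n)) →
    IsConnectedOrientation k H A → IsConnectedOrientation k H A′ →
    Σ[ ℓ ∈ ℕ ] Σ[ S ∈ (Fin (suc ℓ) → List (Hyperarc n)) ]
    ( S zero ↭ A
    × S (fromℕ ℓ) ↭ A′
    × ((i : Fin (suc ℓ)) → IsConnectedOrientation k H (S i))
    × ((i : Fin ℓ) → ReorientsOneTo (S (inject₁ i)) (S (suc i))) )
mainTheorem4 k n H pc A A′ oA oA′ =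
  let (h , gd , p) = orientation⇒good oA
      (h′ , gd′ , p′) = orientation⇒good oA′
  in connect (flips n H pc gd gd′) gd p p′
  where
  open Translation k n H using (orientation⇒good; connect)
  open Translation using (crossing-≥)
  flips : ∀ n (H : Hypergraph n) → PartitionConnected (suc k) H →
    let open Reconfiguration (List.lookup (edges H)) (ℤ.+ k) (+≤+ ℕ.z≤n) in
    ∀ {h h′} → Good h → Good h′ → Star Flip h h′
  -- Without vertices there is no root to choose, but any two head vectors coincide.
  flips zero H pc {h} {h′} gd gd′ = subst (Star _ h) (empty-unique h h′) ε
  flips (suc n) H pc gd gd′ =
    Reconfiguration.reconfigure (List.lookup (edges H)) (ℤ.+ k) (+≤+ ℕ.z≤n) (crossing-≥ k (suc n) H pc) zero gd gd′
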